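{- For $\mathcal{Q}\in\mathrm{PO}(A)$, the antipode $S$ of $\mathbf{ptt}_{\mathrm{NPtt}}$ satisfies $$S(\delta_{\mathrm{UT}_{\mathcal{Q}}})=\sum_{\substack{\mathcal{P}\in\mathrm{PO}(A)\\ \mathrm{Fac}_{\mathcal{Q}}(\mathcal{P})=\{\vec I\}}}(-1)^{\ell_{\mathcal{Q}}(\vec I)-1}\,\delta_{\mathrm{UT}_{\mathcal{P}}},$$ the sum being over those $\mathcal{P}$ having exactly one $\mathcal{Q}$-factorization $\vec I$.
   Context: Fix a finite field $\mathbb{F}_q$ with $q$ elements. All sets are finite; $\mathrm{PO}(A)$ is the set of partial orders on $A$. For $\mathcal{R}\in\mathrm{PO}(A)$, the pattern group is $\mathrm{UT}_{\mathcal{R}}=\{u:\{[i,j]\mid i\preceq_{\mathcal{R}}j\}\to\mathbb{F}_q\mid u([i,i])=1\}$ with product $(uv)([i,k])=\sum_{i\preceq_{\mathcal{R}}j\preceq_{\mathcal{R}}k}u([i,j])v([j,k])$. If $\mathcal{Q}$ is a subposet of $\mathcal{R}$ (i.e. $\mathcal{Q}\in\mathrm{PO}(A)$ and $i\preceq_{\mathcal{Q}}j\Rightarrow i\preceq_{\mathcal{R}}j$), then $\mathrm{UT}_{\mathcal{Q}}\subseteq\mathrm{UT}_{\mathcal{R}}$ via extension by zero. $\mathrm{NPtt}(\mathcal{R})=\{\mathrm{UT}_{\mathcal{Q}}\triangleleft\mathrm{UT}_{\mathcal{R}}\mid\mathcal{Q}\text{ a subposet of }\mathcal{R}\}$, ordered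 by inclusion. $\mathrm{Cl}(\mathcal{R})$ is the partition of $\mathrm{UT}_{\mathcal{R}}$ into the nonempty sets $N_\circ=\{g\in N\mid g\text{ lies in no element of }\mathrm{NPtt}(\mathcal{R})\text{ covered by }N\}$, $N\in\mathrm{NPtt}(\mathcal{R})$, and $\mathrm{f}(\mathrm{UT}_{\mathcal{R}};\mathrm{Cl}(\mathcal{R}))$ is the space of complex functions on $\mathrm{UT}_{\mathcal{R}}$ constant on the blocks of $\mathrm{Cl}(\mathcal{R})$. $\delta_N$ is the indicator function of a subgroup $N$. The Hopf monoid is $\mathbf{ptt}_{\mathrm{NPtt}}[A]=\bigoplus_{\mathcal{R}\in\mathrm{PO}(A)}\mathrm{f}(\mathrm{UT}_{\mathcal{R}};\mathrm{Cl}(\mathcal{R}))$. For disjoint $A,B$, $\mathcal{P}\in\mathrm{PO}(A)$, $\mathcal{Q}\in\mathrm{PO}(B)$, the product is inflation to $\mathrm{UT}_{\mathcal{P}.\mathcal{Q}}$: $m_{A,B}(\phi\otimes\psi)(u)=\phi(u_A)\psi(u_B)$, where $u_A,u_B$ are the restrictions of $u$ to intervals with both endpoints in $A$, resp. $B$, and $\mathcal{P}.\mathcal{Q}\in\mathrm{PO}(A\cup B)$ has $i\preceq j$ iff $i\preceq_{\mathcal{P}}j$, or $i\preceq_{\mathcal{Q}}j$, or $i\in A$ and $j\in B$. For $\mathcal{P}\in\mathrm{PO}(A\cup B)$, the coproduct $\Delta_{A,B}$ restricts functions from $\mathrm{UT}_{\mathcal{P}}$ to the subgroup $\mathrm{UT}_{\mathcal{P}|_A}\times\mathrm{UT}_{\mathcal{P}|_B}$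 of block elements, where $\mathcal{P}|_A$ is the restriction of the order to $A$. The antipode is taken with the sign convention $S=\sum_{(A_1,\ldots,A_\ell)\vDash A}(-1)^{\ell-1}m_{A_1,\ldots,A_\ell}\circ\Delta_{A_1,\ldots,A_\ell}$ (Takeuchi's formula), the sum being over set compositions of $A$ (sequences of nonempty disjoint sets with union $A$), with iterated products and coproducts. The function $\delta_{\mathrm{UT}_{\mathcal{Q}}}$ is regarded as an element of $\mathrm{f}(\mathrm{UT}_{\mathcal{R}};\mathrm{Cl}(\mathcal{R}))$ for some $\mathcal{R}\in\mathrm{PO}(A)$ with $\mathrm{UT}_{\mathcal{Q}}\triangleleft\mathrm{UT}_{\mathcal{R}}$; the formula does not depend on this ambient group, which is suppressed from the notation (the term for $\mathcal{P}$ with factorization $(I_1,\ldots,I_\ell)$ lies in the summand of $\mathcal{R}|_{I_1}.\cdots.\mathcal{R}|_{I_\ell}$). For $\mathcal{P},\mathcal{Q}\in\mathrm{PO}(A)$, a set composition $(I_1,\ldots,I_\ell)\vDash A$ is a $\mathcal{Q}$-factorization of $\mathcal{P}$ if (a) each $\mathcal{P}|_{I_j}$ is a convex subposet of $\mathcal{Q}$ (i.e. $\mathcal{P}|_{I_j}=\mathcal{Q}|_{I_j}$, and $x\prec_{\mathcal{Q}}y\prec_{\mathcal{Q}}z$ with $x,z\in I_j$ implies $y\in I_j$), and (b) all minimal elements of $\mathcal{P}|_{I_j}$ are greater (in $\mathcal{P}$) than the maximal elements of $\mathcal{P}|_{I_{j-1}}$. Its length is $\ell_{\mathcal{Q}}(I_1,\ldots,I_\ell)=\ell$,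 and $\mathrm{Fac}_{\mathcal{Q}}(\mathcal{P})$ is the set of all $\mathcal{Q}$-factorizations of $\mathcal{P}$.
   Formalization: In condition (a) of a Q-factorization of P, blocks are required to be convex in P rather than in Q: with Q-convexity the formula fails for Q the chain 0<1<2, where P = 0<2<1 has one factorization but its coefficient in the antipode is 0. -}

module Defs where

open import Algebra.Bundles using (CommutativeRing)
open import Data.Bool.Base using (Bool; true; false; if_then_else_)
open import Data.Bool.Properties as Bool using ()
open import Data.Empty using (⊥; ⊥-elim)
open import Data.Fin.Base using (Fin; zero; suc; combine; quotient; remainder)
open import Data.Fin.Induction using (spo-wellFounded; spo-noetherian)
open import Data.Fin.Properties as Fin using (all?; any?)
open import Data.Fin.Subset using (Subset; _∈_; _∉_; _⊆_; _∩_; _∪_; ⋃; Empty; Nonempty; _⊂_; _⊃_)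
open import Data.Fin.Subset.Induction using (⊃-wellFounded)
open import Data.Fin.Subset.Properties
  using (_∈?_; nonempty?; p⊆p∪q; q⊆p∪q; x∈p∪q⁻; x∈p∪q⁺; x∈p∩q⁺; x∈p∩q⁻; ∉⊥)
open import Data.List.Base
  using (List; []; _∷_; map; concatMap; mapMaybe; cartesianProductWith; upTo; length; foldr)
open import Data.List.Relation.Unary.All as All using (All; []; _∷_)
open import Data.List.Relation.Unary.AllPairs using (AllPairs; []; _∷_; allPairs?)
open import Data.List.Relation.Unary.Linked using (Linked; []; [-]; _∷_; linked?)
open import Data.Maybe.Base as Maybe using (Maybe)
open import Data.Nat.Base using (ℕ; zero; suc)
open import Data.Product.Base using (∃; Σ; _×_; _,_; proj₁; proj₂; uncurry)
open import Data.Product.Relation.Binary.Pointwise.NonDependent using (×-setoid)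
open import Data.Sum.Base using (_⊎_; inj₁; inj₂)
open import Data.Unit.Polymorphic.Base as Unit using ()
open import Data.Vec.Base as Vec using (Vec; []; _∷_; lookup; tabulate)
open import Data.Vec.Properties as Vec using (lookup∘tabulate; lookup⇒[]=; []=⇒lookup)
open import Function.Base using (_∘_; flip)
open import Function.Bundles using (Func; Inverse)
open import Function.Properties.Inverse using (Inverse⇒Injection)
open import Induction.WellFounded using (Acc; acc)
open import Level using (_⊔_; 0ℓ) renaming (suc to lsuc)
open import Relation.Binary.Bundles using (Setoid)
open import Relation.Binary.Core using (Rel)
open import Relation.Binary.Definitions using (Decidable)
open import Relation.Binary.PropositionalEquality as ≡ using (_≡_; _≢_)
open import Relation.Binary.Structures using (IsStrictPartialOrder)
open import Relation.Nullary.Decidable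
  using (Dec; yes; no; does; map′; _×-dec_; _⊎-dec_; _→-dec_; ¬?; dec⇒maybe; via-injection; decidable-stable;
         False; toWitnessFalse; fromWitnessFalse; dec-true; dec-false)
open import Relation.Nullary.Negation using (¬_; contradiction)
import Algebra.Properties.CommutativeMonoid.Sum as Sum
import Algebra.Properties.Ring as RingProperties
import Algebra.Properties.Semiring.Exp as Exp
import Relation.Binary.Construct.Always as Always
import Function.Construct.Composition as Composition

private
  variable
    n : ℕ
    A B : Subset n

record FiniteField c ℓ : Set (lsuc (c ⊔ ℓ)) where
  field
    commutativeRing : CommutativeRing c ℓ
  open CommutativeRing commutativeRing public
  field
    0≉1         : ¬ 0# ≈ 1#
    inverse     : ∀ x → ¬ x ≈ 0# → ∃ λ y → x * y ≈ 1#
    q           : ℕ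
    enumeration : Inverse setoid (≡.setoid (Fin q))

  _≟_ : Decidable _≈_
  _≟_ = via-injection (Inverse⇒Injection enumeration) Fin._≟_

-- A finite set is a subset A of a set of labels Fin n, so that a block of a
-- set composition is again such a set.  An order on A is a relation on all
-- labels that holds only between elements of A.

record IsPartialOrderOn (A : Subset n) (_⪯_ : Rel (Fin n) 0ℓ) : Set where
  field
    support : ∀ {i j} → i ⪯ j → i ∈ A × j ∈ A
    refl    : ∀ {i} → i ∈ A → i ⪯ i
    antisym : ∀ {i j} → i ⪯ j → j ⪯ i → i ≡ j
    trans   : ∀ {i j k} → i ⪯ j → j ⪯ k → i ⪯ k

record PO {n} (A : Subset n) : Set₁ where
  infix 4 _⪯_ _⪯?_ _≺_ _≺?_
  field
    _⪯_              : Rel (Fin n) 0ℓ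
    _⪯?_             : Decidable _⪯_
    isPartialOrderOn : IsPartialOrderOn A _⪯_
  open IsPartialOrderOn isPartialOrderOn public

  _≺_ : Rel (Fin n) 0ℓ
  i ≺ j = i ⪯ j × i ≢ j

  _≺?_ : Decidable _≺_
  i ≺? j = (i ⪯? j) ×-dec ¬? (i Fin.≟ j)

open PO using (_⪯_; _⪯?_; _≺_; _≺?_)

infix 4 _⊑_ _≗_

_⊑_ : PO A → PO A → Set
Q ⊑ P = ∀ i j → _⪯_ Q i j → _⪯_ P i j

_≗_ : PO A → PO A → Set
Q ≗ P = Q ⊑ P × P ⊑ Q

_⊑?_ : Decidable (_⊑_ {A = A})
Q ⊑? P = all? λ i → all? λ j → (_⪯?_ Q i j) →-dec (_⪯?_ P i j)

_≗?_ : Decidable (_≗_ {A = A})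
Q ≗? P = (Q ⊑? P) ×-dec (P ⊑? Q)

restrict : PO A → (B : Subset n) → B ⊆ A → PO B
restrict P B B⊆A = record
  { _⪯_  = λ i j → i ∈ B × j ∈ B × _⪯_ P i j
  ; _⪯?_ = λ i j → (i ∈? B) ×-dec ((j ∈? B) ×-dec (_⪯?_ P i j))
  ; isPartialOrderOn = record
    { support = λ (i∈B , j∈B , _) → i∈B , j∈B
    ; refl    = λ i∈B → i∈B , i∈B , PO.refl P (B⊆A i∈B)
    ; antisym = λ (_ , _ , i⪯j) (_ , _ , j⪯i) → PO.antisym P i⪯j j⪯i
    ; trans   = λ (i∈B , _ , i⪯j) (_ , k∈B , j⪯k) → i∈B , k∈B , PO.trans P i⪯j j⪯k
    }
  }

Disjoint : Rel (Subset n) 0ℓ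
Disjoint A B = Empty (A ∩ B)

clash : ∀ {i} → Disjoint A B → i ∈ A → i ∈ B → ⊥
clash A#B i∈A i∈B = A#B (_ , x∈p∩q⁺ (i∈A , i∈B))

-- The order written P . Q: everything in A lies below everything in B.
dot : Disjoint A B → PO A → PO B → PO (A ∪ B)
dot {A = A} {B = B} A#B P Q = record
  { _⪯_  = _≤_
  ; _⪯?_ = λ i j → (_⪯?_ P i j) ⊎-dec ((_⪯?_ Q i j) ⊎-dec ((i ∈? A) ×-dec (j ∈? B)))
  ; isPartialOrderOn = record
    { support = support ; refl = refl ; antisym = antisym ; trans = trans }
  }
  where
  _≤_ : Rel (Fin _) 0ℓ
  i ≤ j = _⪯_ P i j ⊎ _⪯_ Q i j ⊎ (i ∈ A × j ∈ B)

  sA₁ : ∀ {i j} → _⪯_ P i j → i ∈ A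
  sA₁ p = proj₁ (PO.support P p)
  sA₂ : ∀ {i j} → _⪯_ P i j → j ∈ A
  sA₂ p = proj₂ (PO.support P p)
  sB₁ : ∀ {i j} → _⪯_ Q i j → i ∈ B
  sB₁ q = proj₁ (PO.support Q q)
  sB₂ : ∀ {i j} → _⪯_ Q i j → j ∈ B
  sB₂ q = proj₂ (PO.support Q q)

  support : ∀ {i j} → i ≤ j → i ∈ (A ∪ B) × j ∈ (A ∪ B)
  support (inj₁ p)                  = x∈p∪q⁺ (inj₁ (sA₁ p)) , x∈p∪q⁺ (inj₁ (sA₂ p))
  support (inj₂ (inj₁ q))           = x∈p∪q⁺ (inj₂ (sB₁ q)) , x∈p∪q⁺ (inj₂ (sB₂ q))
  support (inj₂ (inj₂ (i∈A , j∈B))) = x∈p∪q⁺ (inj₁ i∈A) , x∈p∪q⁺ (inj₂ j∈B)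

  refl : ∀ {i} → i ∈ (A ∪ B) → i ≤ i
  refl i∈ with x∈p∪q⁻ A B i∈
  ... | inj₁ i∈A = inj₁ (PO.refl P i∈A)
  ... | inj₂ i∈B = inj₂ (inj₁ (PO.refl Q i∈B))

  antisym : ∀ {i j} → i ≤ j → j ≤ i → i ≡ j
  antisym (inj₁ p) (inj₁ p′) = PO.antisym P p p′
  antisym (inj₁ p) (inj₂ (inj₁ q)) = ⊥-elim (clash A#B (sA₁ p) (sB₂ q))
  antisym (inj₁ p) (inj₂ (inj₂ (_ , i∈B))) = ⊥-elim (clash A#B (sA₁ p) i∈B)
  antisym (inj₂ (inj₁ q)) (inj₁ p) = ⊥-elim (clash A#B (sA₁ p) (sB₂ q))
  antisym (inj₂ (inj₁ q)) (inj₂ (inj₁ q′)) = PO.antisym Q q q′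
  antisym (inj₂ (inj₁ q)) (inj₂ (inj₂ (j∈A , _))) = ⊥-elim (clash A#B j∈A (sB₂ q))
  antisym (inj₂ (inj₂ (_ , j∈B))) (inj₁ p) = ⊥-elim (clash A#B (sA₁ p) j∈B)
  antisym (inj₂ (inj₂ (i∈A , _))) (inj₂ (inj₁ q)) = ⊥-elim (clash A#B i∈A (sB₂ q))
  antisym (inj₂ (inj₂ (i∈A , _))) (inj₂ (inj₂ (_ , i∈B))) = ⊥-elim (clash A#B i∈A i∈B)

  trans : ∀ {i j k} → i ≤ j → j ≤ k → i ≤ k
  trans (inj₁ p) (inj₁ p′) = inj₁ (PO.trans P p p′)
  trans (inj₁ p) (inj₂ (inj₁ q)) = ⊥-elim (clash A#B (sA₂ p) (sB₁ q))
  trans (inj₁ p) (inj₂ (inj₂ (_ , k∈B))) = inj₂ (inj₂ (sA₁ p , k∈B))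
  trans (inj₂ (inj₁ q)) (inj₁ p) = ⊥-elim (clash A#B (sA₁ p) (sB₂ q))
  trans (inj₂ (inj₁ q)) (inj₂ (inj₁ q′)) = inj₂ (inj₁ (PO.trans Q q q′))
  trans (inj₂ (inj₁ q)) (inj₂ (inj₂ (j∈A , _))) = ⊥-elim (clash A#B j∈A (sB₂ q))
  trans (inj₂ (inj₂ (_ , j∈B))) (inj₁ p) = ⊥-elim (clash A#B (sA₁ p) j∈B)
  trans (inj₂ (inj₂ (i∈A , _))) (inj₂ (inj₁ q)) = inj₂ (inj₂ (i∈A , sB₂ q))
  trans (inj₂ (inj₂ (i∈A , _))) (inj₂ (inj₂ (_ , k∈B))) = inj₂ (inj₂ (i∈A , k∈B))

emptyPO : PO {n} (⋃ [])
emptyPO = record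
  { _⪯_  = λ _ _ → ⊥
  ; _⪯?_ = λ _ _ → no λ ()
  ; isPartialOrderOn = record
    { support = λ () ; refl = λ i∈ → ∉⊥ i∈ ; antisym = λ () ; trans = λ () }
  }

record IsSetComposition (A : Subset n) (Is : List (Subset n)) : Set where
  field
    covers   : ⋃ Is ≡ A
    nonempty : All Nonempty Is
    disjoint : AllPairs Disjoint Is

SetComposition : Subset n → Set
SetComposition A = ∃ (IsSetComposition A)

blocks : {A : Subset n} → SetComposition A → List (Subset n)
blocks = proj₁

disjoint-⋃ : ∀ {I : Subset n} {Is} → All (Disjoint I) Is → Disjoint I (⋃ Is)
disjoint-⋃ {I = I} []                   (i , i∈) = ∉⊥ (proj₂ (x∈p∩q⁻ I _ i∈))
disjoint-⋃ {I = I} {J ∷ Js} (I#J ∷ I#Js) (i , i∈)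
  with i∈I , i∈J∪Js ← x∈p∩q⁻ I _ i∈ with x∈p∪q⁻ J (⋃ Js) i∈J∪Js
... | inj₁ i∈J  = clash I#J i∈I i∈J
... | inj₂ i∈Js = clash (disjoint-⋃ I#Js) i∈I i∈Js

restrict* : (Is : List (Subset n)) → PO (⋃ Is) → All PO Is
restrict* []       P = []
restrict* (I ∷ Is) P =
  restrict P I (p⊆p∪q (⋃ Is)) ∷ restrict* Is (restrict P (⋃ Is) (q⊆p∪q I (⋃ Is)))

dot* : ∀ {Is : List (Subset n)} → AllPairs Disjoint Is → All PO Is → PO (⋃ Is)
dot* []           []       = emptyPO
dot* (I# ∷ disj) (P ∷ Ps) = dot (disjoint-⋃ I#) P (dot* disj Ps)

-- R|_{I₁} . ⋯ . R|_{Iₗ}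
rearrange : PO A → SetComposition A → PO A
rearrange R (Is , record { covers = ≡.refl ; disjoint = disj }) = dot* disj (restrict* Is R)

-- The enumerations below are without repetition (of orders: up to _≗_), so
-- that summing over them is summing over the finite set enumerated.

select : ∀ {x p} {X : Set x} {P : X → Set p} → (∀ x → Dec (P x)) → List X → List (∃ P)
select P? = mapMaybe λ x → Maybe.map (x ,_) (dec⇒maybe (P? x))

vectors : ∀ {x} {X : Set x} → List X → ∀ m → List (Vec X m)
vectors xs zero    = [] ∷ []
vectors xs (suc m) = cartesianProductWith _∷_ xs (vectors xs m)

subsets : ∀ n → List (Subset n)
subsets = vectors (true ∷ false ∷ [])

isSetComposition? : (A : Subset n) → ∀ Is → Dec (IsSetComposition A Is)
isSetComposition? A Is = map′
  (λ (c , e , d) → record { covers = c ; nonempty = e ; disjoint = d })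
  (λ c → let open IsSetComposition c in covers , nonempty , disjoint)
  (Vec.≡-dec Bool._≟_ (⋃ Is) A ×-dec
   (All.all? nonempty? Is ×-dec allPairs? (λ I J → ¬? (nonempty? (I ∩ J))) Is))

blockLists : ∀ n → List (List (Subset n))
blockLists n = concatMap (λ l → map Vec.toList (vectors (subsets n) l)) (upTo (suc n))

-- A set composition of a subset of Fin n has at most n blocks.
compositions : (A : Subset n) → List (SetComposition A)
compositions {n} A = select (isSetComposition? A) (blockLists n)

isPartialOrderOn? : (A : Subset n) {_⪯_ : Rel (Fin n) 0ℓ} → Decidable _⪯_ → Dec (IsPartialOrderOn A _⪯_)
isPartialOrderOn? A _⪯?_ = map′
  (λ (s , r , a , t) → record
    { support = s _ _ ; refl = r _ ; antisym = a _ _ ; trans = t _ _ _ })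
  (λ o → let open IsPartialOrderOn o in
    (λ _ _ → support) , (λ _ → refl) , (λ _ _ → antisym) , (λ _ _ _ → trans))
  ((all? λ i → all? λ j → (i ⪯? j) →-dec ((i ∈? A) ×-dec (j ∈? A))) ×-dec
   ((all? λ i → (i ∈? A) →-dec (i ⪯? i)) ×-dec
    ((all? λ i → all? λ j → (i ⪯? j) →-dec ((j ⪯? i) →-dec (i Fin.≟ j))) ×-dec
     (all? λ i → all? λ j → all? λ k → (i ⪯? j) →-dec ((j ⪯? k) →-dec (i ⪯? k))))))

-- Row i of the matrix of an order is the up-set of i.
Matrix : ℕ → Set
Matrix n = Vec (Subset n) n

relation : Matrix n → Rel (Fin n) 0ℓ
relation M i j = j ∈ lookup M i

relation? : (M : Matrix n) → Decidable (relation M)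
relation? M i j = j ∈? lookup M i

fromMatrix : ∃ (λ M → IsPartialOrderOn A (relation M)) → PO A
fromMatrix (M , isPO) = record { _⪯?_ = relation? M ; isPartialOrderOn = isPO }

posets : (A : Subset n) → List (PO A)
posets {n} A = map fromMatrix
  (select (λ M → isPartialOrderOn? A (relation? M)) (vectors (subsets n) n))

module _ {n} {A : Subset n} where

  -- P|_I = Q|_I
  Agree : PO A → PO A → Subset n → Set
  Agree P Q I = ∀ i j → i ∈ I → j ∈ I → (_⪯_ P i j → _⪯_ Q i j) × (_⪯_ Q i j → _⪯_ P i j)

  -- In a Q-factorization of P the blocks are convex with respect to P.  It
  -- would not do to ask for convexity with respect to Q: if Q is the chain
  -- 0 < 1 < 2, the only factorization of the chain 0 < 2 < 1 with Q-convex
  -- blocks is ({0},{2},{1}), but this term cancels in the antipode against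
  -- that of ({0,2},{1}).
  Convex : PO A → Subset n → Set
  Convex P I = ∀ x y z → x ∈ I → z ∈ I → _≺_ P x y → _≺_ P y z → y ∈ I

  Maximal Minimal : PO A → Subset n → Fin n → Set
  Maximal P I x = x ∈ I × (∀ y → y ∈ I → ¬ _≺_ P x y)
  Minimal P I x = x ∈ I × (∀ y → y ∈ I → ¬ _≺_ P y x)

  Below : PO A → Rel (Subset n) 0ℓ
  Below P I J = ∀ x y → Maximal P I x → Minimal P J y → _≺_ P x y

  record IsFactorization (Q P : PO A) (Is : List (Subset n)) : Set where
    field
      agree  : All (Agree P Q) Is
      convex : All (Convex P) Is
      below  : Linked (Below P) Is

  isFactorization? : ∀ Q P Is → Dec (IsFactorization Q P Is)
  isFactorization? Q P Is = map′
    (λ (a , c , b) → record { agree = a ; convex = c ; below = b })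
    (λ f → let open IsFactorization f in agree , convex , below)
    (All.all? agree? Is ×-dec (All.all? convex? Is ×-dec linked? below? Is))
    where
    agree? : ∀ I → Dec (Agree P Q I)
    agree? I = all? λ i → all? λ j → (i ∈? I) →-dec ((j ∈? I) →-dec
      (((_⪯?_ P i j) →-dec (_⪯?_ Q i j)) ×-dec ((_⪯?_ Q i j) →-dec (_⪯?_ P i j))))

    convex? : ∀ I → Dec (Convex P I)
    convex? I = all? λ x → all? λ y → all? λ z → (x ∈? I) →-dec ((z ∈? I) →-dec
      ((_≺?_ P x y) →-dec ((_≺?_ P y z) →-dec (y ∈? I))))

    below? : ∀ I J → Dec (Below P I J)
    below? I J = all? λ x → all? λ y →
      ((x ∈? I) ×-dec (all? λ z → (z ∈? I) →-dec ¬? (_≺?_ P x z))) →-dec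
      (((y ∈? J) ×-dec (all? λ z → (z ∈? J) →-dec ¬? (_≺?_ P z y))) →-dec
      (_≺?_ P x y))

  Factorization : PO A → PO A → Set
  Factorization Q P = Σ (SetComposition A) λ I → IsFactorization Q P (blocks I)

  Fac : ∀ Q P → List (Factorization Q P)
  Fac Q P = select (λ I → isFactorization? Q P (blocks I)) (compositions A)

-- If P has the Q-factorization I, then P = Q|_{I₁} . ⋯ . Q|_{Iₗ}.

module _ {n} {A : Subset n} (P : PO A) where

  isSPO : IsStrictPartialOrder _≡_ (_≺_ P)
  isSPO = record
    { isEquivalence = ≡.isEquivalence
    ; irrefl        = λ i≡j (_ , i≢j) → i≢j i≡j
    ; trans         = λ { (i⪯j , i≢j) (j⪯k , _) → PO.trans P i⪯j j⪯k ,
                          λ { ≡.refl → i≢j (PO.antisym P i⪯j j⪯k) } }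
    ; <-resp-≈      = ≡.resp₂ (_≺_ P)
    }

  maximalAbove : ∀ I → I ⊆ A → ∀ x → x ∈ I → ∃ λ m → Maximal P I m × _⪯_ P x m
  maximalAbove I I⊆A x x∈I = go x x∈I (spo-noetherian isSPO x)
    where
    go : ∀ x → x ∈ I → Acc (flip (_≺_ P)) x → ∃ λ m → Maximal P I m × _⪯_ P x m
    go x x∈I (acc rs) with any? (λ y → (y ∈? I) ×-dec (_≺?_ P x y))
    ... | yes (y , y∈I , x≺y) with m , mx , y⪯m ← go y y∈I (rs x≺y) =
            m , mx , PO.trans P (proj₁ x≺y) y⪯m
    ... | no ∄y = x , (x∈I , λ y y∈I x≺y → ∄y (y , y∈I , x≺y)) , PO.refl P (I⊆A x∈I)

  minimalBelow : ∀ I → I ⊆ A → ∀ x → x ∈ I → ∃ λ m → Minimal P I m × _⪯_ P m x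
  minimalBelow I I⊆A x x∈I = go x x∈I (spo-wellFounded isSPO x)
    where
    go : ∀ x → x ∈ I → Acc (_≺_ P) x → ∃ λ m → Minimal P I m × _⪯_ P m x
    go x x∈I (acc rs) with any? (λ y → (y ∈? I) ×-dec (_≺?_ P y x))
    ... | yes (y , y∈I , y≺x) with m , mn , m⪯y ← go y y∈I (rs y≺x) =
            m , mn , PO.trans P m⪯y (proj₁ y≺x)
    ... | no ∄y = x , (x∈I , λ y y∈I y≺x → ∄y (y , y∈I , y≺x)) , PO.refl P (I⊆A x∈I)

  below-adjacent : ∀ {I J} → I ⊆ A → J ⊆ A → Below P I J → ∀ x y → x ∈ I → y ∈ J → _⪯_ P x y
  below-adjacent {I} {J} I⊆A J⊆A I<J x y x∈I y∈J
    with a , mx , x⪯a ← maximalAbove I I⊆A x x∈I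
       | b , mn , b⪯y ← minimalBelow J J⊆A y y∈J
    = PO.trans P x⪯a (PO.trans P (proj₁ (I<J a b mx mn)) b⪯y)

  below-⋃ : ∀ {I Is} → (I ∪ ⋃ Is) ⊆ A → All Nonempty Is → Linked (Below P) (I ∷ Is) →
            ∀ x y → x ∈ I → y ∈ ⋃ Is → _⪯_ P x y
  below-⋃ {Is = []}     _  _ _ x y _ y∈ = ⊥-elim (∉⊥ y∈)
  below-⋃ {I} {J ∷ Js} sub ((z , z∈J) ∷ ne) (I<J ∷ rest) x y x∈I y∈
    with x∈p∪q⁻ J (⋃ Js) y∈
  ... | inj₁ y∈J  = below-adjacent (sub ∘ p⊆p∪q _) (sub ∘ q⊆p∪q I _ ∘ p⊆p∪q _) I<J x y x∈I y∈J
  ... | inj₂ y∈Js = PO.trans P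
    (below-adjacent (sub ∘ p⊆p∪q _) (sub ∘ q⊆p∪q I _ ∘ p⊆p∪q _) I<J x z x∈I z∈J)
    (below-⋃ (sub ∘ q⊆p∪q I _) ne rest z y z∈J y∈Js)

Agree-trans : ∀ {P Q R : PO A} {I} → Agree P Q I → Agree Q R I → Agree P R I
Agree-trans pq qr i j i∈I j∈I =
  (proj₁ (qr i j i∈I j∈I) ∘ proj₁ (pq i j i∈I j∈I)) ,
  (proj₂ (pq i j i∈I j∈I) ∘ proj₂ (qr i j i∈I j∈I))

linked-tail : ∀ {ℓ} {R : Rel (Subset n) ℓ} {I Is} → Linked R (I ∷ Is) → Linked R Is
linked-tail [-]      = []
linked-tail (_ ∷ rs) = rs

module _ {n} {A : Subset n} (P Q : PO A) where

  Restricts : ∀ {B} → PO B → PO A → Set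
  Restricts {B} P′ P = ∀ i j → i ∈ B → j ∈ B → (_⪯_ P′ i j → _⪯_ P i j) × (_⪯_ P i j → _⪯_ P′ i j)

  dot*-≗ : ∀ {Is} (sub : ⋃ Is ⊆ A) (P′ Q′ : PO (⋃ Is)) → Restricts P′ P → Restricts Q′ Q →
           All (Agree P Q) Is → Linked (Below P) Is → All Nonempty Is →
           (disj : AllPairs Disjoint Is) → P′ ≗ dot* disj (restrict* Is Q′)
  dot*-≗ {[]} sub P′ Q′ rP rQ _ _ _ [] = (λ i j p → ∉⊥ (proj₁ (PO.support P′ p))) , λ i j ()
  dot*-≗ {I ∷ Is} sub P′ Q′ rP rQ (a ∷ as) lnk (_ ∷ ne) (I# ∷ disj) = to , from
    where
    I⊆  = p⊆p∪q {p = I} (⋃ Is)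
    Is⊆ = q⊆p∪q I (⋃ Is)
    P″ = restrict P′ (⋃ Is) Is⊆
    Q″ = restrict Q′ (⋃ Is) Is⊆
    IH : P″ ≗ dot* disj (restrict* Is Q″)
    IH = dot*-≗ (sub ∘ Is⊆) P″ Q″
      (λ i j i∈ j∈ → (λ (_ , _ , p) → proj₁ (rP i j (Is⊆ i∈) (Is⊆ j∈)) p) ,
                     (λ p → i∈ , j∈ , proj₂ (rP i j (Is⊆ i∈) (Is⊆ j∈)) p))
      (λ i j i∈ j∈ → (λ (_ , _ , p) → proj₁ (rQ i j (Is⊆ i∈) (Is⊆ j∈)) p) ,
                     (λ p → i∈ , j∈ , proj₂ (rQ i j (Is⊆ i∈) (Is⊆ j∈)) p))
      as (linked-tail lnk) ne disj

    to : P′ ⊑ dot* (I# ∷ disj) (restrict* (I ∷ Is) Q′)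
    to i j p with i∈ , j∈ ← PO.support P′ p with x∈p∪q⁻ I (⋃ Is) i∈ | x∈p∪q⁻ I (⋃ Is) j∈
    ... | inj₁ i∈I | inj₁ j∈I = inj₁ (i∈I , j∈I ,
            proj₂ (rQ i j i∈ j∈) (proj₁ (a i j i∈I j∈I) (proj₁ (rP i j i∈ j∈) p)))
    ... | inj₁ i∈I | inj₂ j∈Is = inj₂ (inj₂ (i∈I , j∈Is))
    ... | inj₂ i∈Is | inj₂ j∈Is = inj₂ (inj₁ (proj₁ IH i j (i∈Is , j∈Is , p)))
    ... | inj₂ i∈Is | inj₁ j∈I
            with ≡.refl ← PO.antisym P (proj₁ (rP i j i∈ j∈) p) (below-⋃ P sub ne lnk j i j∈I i∈Is)
            = ⊥-elim (clash (disjoint-⋃ I#) j∈I i∈Is)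

    from : dot* (I# ∷ disj) (restrict* (I ∷ Is) Q′) ⊑ P′
    from i j (inj₁ (i∈I , j∈I , q)) =
      proj₂ (rP i j (I⊆ i∈I) (I⊆ j∈I))
        (proj₂ (a i j i∈I j∈I) (proj₁ (rQ i j (I⊆ i∈I) (I⊆ j∈I)) q))
    from i j (inj₂ (inj₁ q)) with _ , _ , p ← proj₂ IH i j q = p
    from i j (inj₂ (inj₂ (i∈I , j∈Is))) =
      proj₂ (rP i j (I⊆ i∈I) (Is⊆ j∈Is)) (below-⋃ P sub ne lnk i j i∈I j∈Is)

factorization-≗ : ∀ {n} {A : Subset n} {Q P : PO A} ((I , _) : Factorization Q P) → P ≗ rearrange Q I
factorization-≗ {Q = Q} {P} ((Is , record { covers = ≡.refl ; nonempty = ne ; disjoint = disj }) , fac) =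
  dot*-≗ P Q (λ x∈ → x∈) P Q (λ i j _ _ → (λ p → p) , (λ p → p)) (λ i j _ _ → (λ p → p) , (λ p → p))
    (IsFactorization.agree fac) (IsFactorization.below fac) ne disj

-- The relation of N is, off the diagonal, an ideal in that of R.
Ideal : PO A → PO A → Set
Ideal N R = N ⊑ R × (∀ i j k l → _⪯_ R i j → _≺_ N j k → _⪯_ R k l → _⪯_ N i l)

ideal-≗ : ∀ {N M R : PO A} → M ≗ N → Ideal N R → Ideal M R
ideal-≗ (M⊑N , N⊑M) (N⊑R , ideal) =
  (λ i j → N⊑R i j ∘ M⊑N i j) ,
  (λ i j k l p (m , j≢k) r → N⊑M i l (ideal i j k l p (M⊑N j k m , j≢k) r))

ideal-restrict : ∀ {N R : PO A} {B⊆A : B ⊆ A} → Ideal N R → Ideal (restrict N B B⊆A) (restrict R B B⊆A)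
ideal-restrict (N⊑R , ideal) =
  (λ i j (i∈ , j∈ , m) → i∈ , j∈ , N⊑R i j m) ,
  (λ i j k l (i∈ , _ , p) ((_ , _ , m) , j≢k) (_ , l∈ , r) → i∈ , l∈ , ideal i j k l p (m , j≢k) r)

ideal-dot : ∀ {A#B : Disjoint A B} {M P : PO A} {N Q : PO B} →
            Ideal M P → Ideal N Q → Ideal (dot A#B M N) (dot A#B P Q)
ideal-dot {A = A} {B = B} {A#B} {M} {P} {N} {Q} (M⊑P , idM) (N⊑Q , idN) = sub , ideal
  where
  L = dot A#B M N
  R = dot A#B P Q
  sub : L ⊑ R
  sub i j (inj₁ m)        = inj₁ (M⊑P i j m)
  sub i j (inj₂ (inj₁ m)) = inj₂ (inj₁ (N⊑Q i j m))
  sub i j (inj₂ (inj₂ m)) = inj₂ (inj₂ m)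

  inA : ∀ {i j} → _⪯_ R i j → j ∈ A → i ∈ A × _⪯_ P i j
  inA (inj₁ p)              _   = proj₁ (PO.support P p) , p
  inA (inj₂ (inj₁ q))       j∈A = ⊥-elim (clash A#B j∈A (proj₂ (PO.support Q q)))
  inA (inj₂ (inj₂ (_ , b))) j∈A = ⊥-elim (clash A#B j∈A b)

  inB : ∀ {i j} → _⪯_ R i j → i ∈ B → j ∈ B × _⪯_ Q i j
  inB (inj₁ p)              i∈B = ⊥-elim (clash A#B (proj₁ (PO.support P p)) i∈B)
  inB (inj₂ (inj₁ q))       _   = proj₂ (PO.support Q q) , q
  inB (inj₂ (inj₂ (a , _))) i∈B = ⊥-elim (clash A#B a i∈B)

  LA : ∀ {i j} → _⪯_ L i j → j ∈ A → _⪯_ M i j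
  LA (inj₁ m)              _   = m
  LA (inj₂ (inj₁ m))       j∈A = ⊥-elim (clash A#B j∈A (proj₂ (PO.support N m)))
  LA (inj₂ (inj₂ (_ , b))) j∈A = ⊥-elim (clash A#B j∈A b)

  LB : ∀ {i j} → _⪯_ L i j → i ∈ B → _⪯_ N i j
  LB (inj₁ m)              i∈B = ⊥-elim (clash A#B (proj₁ (PO.support M m)) i∈B)
  LB (inj₂ (inj₁ m))       _   = m
  LB (inj₂ (inj₂ (a , _))) i∈B = ⊥-elim (clash A#B a i∈B)

  ideal : ∀ i j k l → _⪯_ R i j → _≺_ L j k → _⪯_ R k l → _⪯_ L i l
  ideal i j k l p (m , j≢k) r with PO.trans R p (PO.trans R (sub j k m) r)
  ... | inj₂ (inj₂ il) = inj₂ (inj₂ il)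
  ... | inj₁ il
      with k∈A , r′ ← inA r (proj₂ (PO.support P il))
      with m′ ← LA m k∈A
      with _ , p′ ← inA p (proj₁ (PO.support M m′))
      = inj₁ (idM i j k l p′ (m′ , j≢k) r′)
  ... | inj₂ (inj₁ il)
      with j∈B , p′ ← inB p (proj₁ (PO.support Q il))
      with m′ ← LB m j∈B
      with _ , r′ ← inB r (proj₂ (PO.support N m′))
      = inj₂ (inj₁ (idN i j k l p′ (m′ , j≢k) r′))

ideal-refl : (R : PO A) → Ideal R R
ideal-refl R = (λ _ _ r → r) , λ i j k l p (m , _) r → PO.trans R p (PO.trans R m r)

ideal-dot* : ∀ {Is : List (Subset n)} (disj : AllPairs Disjoint Is) (N R : PO (⋃ Is)) →
             Ideal N R → Ideal (dot* disj (restrict* Is N)) (dot* disj (restrict* Is R))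
ideal-dot* []          N R ideal = ideal-refl emptyPO
ideal-dot* {Is = I ∷ Is} (I# ∷ disj) N R ideal =
  ideal-dot {A#B = disjoint-⋃ I#}
    {restrict N I I⊆} {restrict R I I⊆}
    {dot* disj (restrict* Is (restrict N _ Is⊆))} {dot* disj (restrict* Is (restrict R _ Is⊆))}
    (ideal-restrict {N = N} {R} {I⊆} ideal)
    (ideal-dot* disj _ _ (ideal-restrict {N = N} {R} {Is⊆} ideal))
  where
  I⊆ : I ⊆ (I ∪ ⋃ Is)
  I⊆  = p⊆p∪q (⋃ Is)
  Is⊆ : ⋃ Is ⊆ (I ∪ ⋃ Is)
  Is⊆ = q⊆p∪q I (⋃ Is)

ideal-rearrange : ∀ {N R : PO A} (I : SetComposition A) → Ideal N R → Ideal (rearrange N I) (rearrange R I)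
ideal-rearrange (_ , record { covers = ≡.refl ; disjoint = disj }) = ideal-dot* disj _ _

module PatternGroup {c ℓ} (F : FiniteField c ℓ) where

  open FiniteField F hiding (q; inverse; zero)
  open Sum +-commutativeMonoid using (sum; sum-syntax; sum-cong-≋; sum-replicate-zero)
  open RingProperties ring using (-‿involutive)

  -- A function on the intervals of R, stored with its extension by zero
  -- to all pairs of labels.
  record UT {n} {A : Subset n} (R : PO A) : Set (c ⊔ ℓ) where
    field
      entry   : Fin n → Fin n → Carrier
      support : ∀ {i j} → ¬ _⪯_ R i j → entry i j ≈ 0#
      unit    : ∀ {i} → i ∈ A → entry i i ≈ 1#

  open UT using (entry)

  infix 4 _≋_ _∈UT_ _◁_
  infixl 7 _∙_

  _≋_ : {R : PO A} → UT R → UT R → Set ℓ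
  u ≋ v = ∀ i j → entry u i j ≈ entry v i j

  sum-0 : ∀ {n} {t : Fin n → Carrier} → (∀ j → t j ≈ 0#) → sum t ≈ 0#
  sum-0 {n} t≈0 = trans (sum-cong-≋ t≈0) (sum-replicate-zero n)

  sum-1 : ∀ {n} {t : Fin n → Carrier} k → (∀ j → j ≢ k → t j ≈ 0#) → sum t ≈ t k
  sum-1 zero    t≈0 = trans (+-congˡ (sum-0 λ j → t≈0 (suc j) λ ())) (+-identityʳ _)
  sum-1 (suc k) t≈0 = trans
    (+-cong (t≈0 zero λ ()) (sum-1 k λ j j≢k → t≈0 (suc j) (j≢k ∘ Fin.suc-injective)))
    (+-identityˡ _)

  sum-2 : ∀ {n} {t : Fin n → Carrier} k l → k ≢ l →
          (∀ j → j ≢ k → j ≢ l → t j ≈ 0#) → sum t ≈ t k + t l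
  sum-2 zero    zero    k≢l _   = contradiction ≡.refl k≢l
  sum-2 zero    (suc l) k≢l t≈0 =
    +-congˡ (sum-1 l λ j j≢l → t≈0 (suc j) (λ ()) (j≢l ∘ Fin.suc-injective))
  sum-2 (suc k) zero    k≢l t≈0 = trans
    (+-congˡ (sum-1 k λ j j≢k → t≈0 (suc j) (j≢k ∘ Fin.suc-injective) (λ ())))
    (+-comm _ _)
  sum-2 (suc k) (suc l) k≢l t≈0 = trans
    (+-cong (t≈0 zero (λ ()) (λ ()))
      (sum-2 k l (k≢l ∘ ≡.cong suc) λ j j≢k j≢l →
        t≈0 (suc j) (j≢k ∘ Fin.suc-injective) (j≢l ∘ Fin.suc-injective)))
    (+-identityˡ _)

  0*  : ∀ {x y} → x ≈ 0# → x * y ≈ 0#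
  0* x≈0 = trans (*-congʳ x≈0) (zeroˡ _)

  *0  : ∀ {x y} → y ≈ 0# → x * y ≈ 0#
  *0 y≈0 = trans (*-congˡ y≈0) (zeroʳ _)

  1*  : ∀ {x y} → x ≈ 1# → x * y ≈ y
  1* x≈1 = trans (*-congʳ x≈1) (*-identityˡ _)

  *1  : ∀ {x y} → y ≈ 1# → x * y ≈ x
  *1 y≈1 = trans (*-congˡ y≈1) (*-identityʳ _)

  if-true : ∀ {p x} {P : Set p} {X : Set x} (d : Dec P) {a b : X} → P → (if does d then a else b) ≡ a
  if-true d p = ≡.cong (if_then _ else _) (dec-true d p)

  if-false : ∀ {p x} {P : Set p} {X : Set x} (d : Dec P) {a b : X} → ¬ P → (if does d then a else b) ≡ b
  if-false d ¬p = ≡.cong (if_then _ else _) (dec-false d ¬p)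

  _∙_ : {R : PO A} → UT R → UT R → UT R
  _∙_ {n} {A = A} {R = R} u v = record
    { entry   = λ i k → ∑[ j < n ] (entry u i j * entry v j k)
    ; support = λ i⋠k → sum-0 λ j → term-0 i⋠k j
    ; unit    = λ {i} i∈A → trans
        (sum-1 i λ j j≢i → term-≢ i j j≢i)
        (trans (1* (UT.unit u i∈A)) (UT.unit v i∈A))
    }
    where
    term-0 : ∀ {i k} → ¬ _⪯_ R i k → ∀ j → entry u i j * entry v j k ≈ 0#
    term-0 {i} {k} i⋠k j with _⪯?_ R i j
    ... | yes i⪯j = *0 (UT.support v λ j⪯k → i⋠k (PO.trans R i⪯j j⪯k))
    ... | no  i⋠j = 0* (UT.support u i⋠j)

    term-≢ : ∀ i j → j ≢ i → entry u i j * entry v j i ≈ 0#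
    term-≢ i j j≢i with _⪯?_ R i j
    ... | yes i⪯j = *0 (UT.support v λ j⪯i → j≢i (PO.antisym R j⪯i i⪯j))
    ... | no  i⋠j = 0* (UT.support u i⋠j)

  ε : {R : PO A} → UT R
  ε {A = A} {R = R} = record
    { entry   = λ i j → if does (diag? i j) then 1# else 0#
    ; support = λ {i} {j} i⋠j → reflexive (if-false (diag? i j) λ { (≡.refl , i∈A) → i⋠j (PO.refl R i∈A) })
    ; unit    = λ {i} i∈A → reflexive (if-true (diag? i i) (≡.refl , i∈A))
    }
    where
    diag? : ∀ i j → Dec (i ≡ j × i ∈ A)
    diag? i j = (i Fin.≟ j) ×-dec (i ∈? A)

  extend : {Q R : PO A} → Q ⊑ R → UT Q → UT R
  extend Q⊑R u = record
    { entry   = entry u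
    ; support = λ i⋠j → UT.support u (i⋠j ∘ Q⊑R _ _)
    ; unit    = UT.unit u
    }

  -- The element u of UT_R lies in the image of extend, for Q ⊑ R.
  _∈UT_ : {R : PO A} → UT R → PO A → Set ℓ
  u ∈UT Q = ∀ i j → ¬ _⪯_ Q i j → entry u i j ≈ 0#

  _∈UT?_ : {R : PO A} (u : UT R) (Q : PO A) → Dec (u ∈UT Q)
  u ∈UT? Q = all? λ i → all? λ j → ¬? (_⪯?_ Q i j) →-dec (entry u i j ≟ 0#)

  -- UT_Q is a normal subgroup of UT_R.  As UT_R is a finite group, g ∙ g′ ≋ ε
  -- says that g′ is the inverse of g.
  record _◁_ {n} {A : Subset n} (Q R : PO A) : Set (c ⊔ ℓ) where
    constructor _,_
    field
      subposet : Q ⊑ R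
      normal   : ∀ (g g′ h : UT R) → g ∙ g′ ≋ ε → h ∈UT Q → (g ∙ h) ∙ g′ ∈UT Q

  NPtt : PO A → Set (lsuc 0ℓ ⊔ c ⊔ ℓ)
  NPtt R = ∃ λ N → N ◁ R

  module _ {n} {A : Subset n} {R : PO A} where

    infix 4 _≤_ _<_ _⋖_ _∈∘_

    _≤_ : Rel (NPtt R) (c ⊔ ℓ)
    (M , _) ≤ (N , _) = ∀ (u : UT R) → u ∈UT M → u ∈UT N

    _<_ : Rel (NPtt R) (c ⊔ ℓ)
    M < N = M ≤ N × ¬ N ≤ M

    -- M is covered by N.
    _⋖_ : Rel (NPtt R) (lsuc 0ℓ ⊔ c ⊔ ℓ)
    M ⋖ N = M < N × (∀ K → M < K → ¬ K < N)

    -- Membership in N_∘.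
    _∈∘_ : UT R → NPtt R → Set (lsuc 0ℓ ⊔ c ⊔ ℓ)
    g ∈∘ N = g ∈UT proj₁ N × (∀ M → M ⋖ N → ¬ g ∈UT proj₁ M)

    record SameBlock (g h : UT R) : Set (lsuc 0ℓ ⊔ c ⊔ ℓ) where
      constructor both
      field
        {N} : NPtt R
        g∈∘ : g ∈∘ N
        h∈∘ : h ∈∘ N

  -- UT_N is normal in UT_R exactly when N is an ideal of R.

  module _ {n} {A : Subset n} {R : PO A} where

    ε-≢ : ∀ {i j} → i ≢ j → entry (ε {R = R}) i j ≈ 0#
    ε-≢ {i} {j} i≢j = reflexive (if-false ((i Fin.≟ j) ×-dec (i ∈? A)) (i≢j ∘ proj₁))

    ideal⇒normal : ∀ {N} → Ideal N R → N ◁ R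
    ideal⇒normal {N} (N⊑R , ideal) = N⊑R , normal
      where
      normal : ∀ (g g′ h : UT R) → g ∙ g′ ≋ ε → h ∈UT N → (g ∙ h) ∙ g′ ∈UT N
      normal g g′ h gg′≋ε h∈N i l i⋠l = trans (sum-cong-≋ term) (trans (gg′≋ε i l) ε≈0)
        where
        ε≈0 : entry (ε {R = R}) i l ≈ 0#
        ε≈0 = reflexive (if-false ((i Fin.≟ l) ×-dec (i ∈? A)) λ { (≡.refl , i∈A) → i⋠l (PO.refl N i∈A) })

        inner : ∀ k → _⪯_ R k l → ∀ j → j ≢ k → entry g i j * entry h j k ≈ 0#
        inner k k⪯l j j≢k with _⪯?_ R i j
        ... | no  i⋠j = 0* (UT.support g i⋠j)
        ... | yes i⪯j = *0 (h∈N j k λ j⪯k → i⋠l (ideal i j k l i⪯j (j⪯k , j≢k) k⪯l))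

        term : ∀ k → entry (g ∙ h) i k * entry g′ k l ≈ entry g i k * entry g′ k l
        term k with _⪯?_ R k l
        ... | no  k⋠l = trans (*0 (UT.support g′ k⋠l)) (sym (*0 (UT.support g′ k⋠l)))
        ... | yes k⪯l = *-congʳ (trans (sum-1 k (inner k k⪯l))
                          (*1 (UT.unit h (proj₁ (PO.support R k⪯l)))))

    -- The matrix 1 + a e_{ij}.
    transvection : ∀ {i j} → _≺_ R i j → Carrier → UT R
    transvection {i} {j} (i⪯j , i≢j) a = record
      { entry   = λ x y → if does (at? x y) then a else entry (ε {R = R}) x y
      ; support = λ {x} {y} x⋠y → trans
          (reflexive (if-false (at? x y) λ { (≡.refl , ≡.refl) → x⋠y i⪯j }))
          (UT.support (ε {R = R}) x⋠y)
      ; unit    = λ {x} x∈A → trans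
          (reflexive (if-false (at? x x) λ { (≡.refl , i≡j) → i≢j i≡j }))
          (UT.unit (ε {R = R}) x∈A)
      }
      where
      at? : ∀ x y → Dec (x ≡ i × y ≡ j)
      at? x y = (x Fin.≟ i) ×-dec (y Fin.≟ j)

    module _ {i j} (i≺j : _≺_ R i j) (a : Carrier) where
      private
        T : UT R
        T = transvection i≺j a
        i∈A = proj₁ (PO.support R (proj₁ i≺j))
        j∈A = proj₂ (PO.support R (proj₁ i≺j))

      T-at : entry T i j ≈ a
      T-at = reflexive (if-true ((i Fin.≟ i) ×-dec (j Fin.≟ j)) (≡.refl , ≡.refl))

      T-else : ∀ {x y} → ¬ (x ≡ i × y ≡ j) → entry T x y ≈ entry (ε {R = R}) x y
      T-else {x} {y} ¬at = reflexive (if-false ((x Fin.≟ i) ×-dec (y Fin.≟ j)) ¬at)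

      T-0 : ∀ {x y} → ¬ (x ≡ i × y ≡ j) → x ≢ y → entry T x y ≈ 0#
      T-0 ¬at x≢y = trans (T-else ¬at) (ε-≢ x≢y)

      T-row : (w : Fin n → Carrier) → ∑[ m < n ] (entry T i m * w m) ≈ w i + a * w j
      T-row w = trans
        (sum-2 i j (proj₂ i≺j) λ m m≢i m≢j → 0* (T-0 (m≢j ∘ proj₂) (m≢i ∘ ≡.sym)))
        (+-cong (1* (UT.unit T i∈A)) (*-congʳ T-at))

      T-row′ : ∀ {x} → x ∈ A → x ≢ i → (w : Fin n → Carrier) → ∑[ m < n ] (entry T x m * w m) ≈ w x
      T-row′ {x} x∈A x≢i w = trans
        (sum-1 x λ m m≢x → 0* (T-0 (x≢i ∘ proj₁) (m≢x ∘ ≡.sym)))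
        (1* (UT.unit T x∈A))

      T-col′ : ∀ {y} → y ∈ A → y ≢ j → (w : Fin n → Carrier) → ∑[ m < n ] (w m * entry T m y) ≈ w y
      T-col′ {y} y∈A y≢j w = trans
        (sum-1 y λ m m≢y → *0 (T-0 (y≢j ∘ proj₂) m≢y))
        (*1 (UT.unit T y∈A))

    T-inverse : ∀ {i j} (i≺j : _≺_ R i j) a b → b + a ≈ 0# → transvection i≺j a ∙ transvection i≺j b ≋ ε
    T-inverse {i} {j} i≺j a b b+a≈0 x y = go (x ∈? A) (x Fin.≟ i) (y Fin.≟ j)
      where
      T : Carrier → UT R
      T = transvection i≺j

      go : Dec (x ∈ A) → Dec (x ≡ i) → Dec (y ≡ j) → entry (T a ∙ T b) x y ≈ entry (ε {R = R}) x y
      go (no x∉A) _ _ = trans (UT.support (T a ∙ T b) x⋠y) (sym (UT.support (ε {R = R}) x⋠y))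
        where
        x⋠y : ¬ _⪯_ R x y
        x⋠y x⪯y = x∉A (proj₁ (PO.support R x⪯y))
      go (yes x∈A) (no x≢i) _ = trans (T-row′ i≺j a x∈A x≢i _) (T-else i≺j b (x≢i ∘ proj₁))
      go (yes x∈A) (yes ≡.refl) (yes ≡.refl) = trans (T-row i≺j a _) (trans
        (+-cong (T-at i≺j b) (*1 (UT.unit (T b) (proj₂ (PO.support R (proj₁ i≺j))))))
        (trans b+a≈0 (sym (ε-≢ (proj₂ i≺j)))))
      go (yes x∈A) (yes ≡.refl) (no y≢j) = trans (T-row i≺j a _) (trans
        (+-cong (T-else i≺j b {i} {y} (y≢j ∘ proj₂))
          (*0 (T-0 i≺j b (proj₂ i≺j ∘ ≡.sym ∘ proj₁) (y≢j ∘ ≡.sym))))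
        (+-identityʳ _))

    ∈UT-transvection : ∀ {N : PO A} {i j} (i≺j : _≺_ R i j) a → N ⊑ R →
                       _⪯_ N i j → transvection i≺j a ∈UT N
    ∈UT-transvection {N} {i} {j} i≺j a N⊑R i⪯j x y x⋠y = trans
      (T-else i≺j a {x} {y} λ { (≡.refl , ≡.refl) → x⋠y i⪯j })
      (reflexive (if-false ((x Fin.≟ y) ×-dec (x ∈? A)) λ { (≡.refl , x∈A) → x⋠y (PO.refl N x∈A) }))

    nonzero⇒⪯ : ∀ {N : PO A} (u : UT R) {i j} → u ∈UT N → entry u i j ≈ 1# → _⪯_ N i j
    nonzero⇒⪯ {N} u {i} {j} u∈N u≈1 with _⪯?_ N i j
    ... | yes i⪯j = i⪯j
    ... | no  i⋠j = contradiction (trans (sym (u∈N i j i⋠j)) u≈1) 0≉1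

    normal⇒ideal : ∀ {N} → N ◁ R → Ideal N R
    normal⇒ideal {N} (N⊑R , normal) = N⊑R , ideal
      where
      left : ∀ i j k → _⪯_ R i j → _≺_ N j k → _⪯_ N i k
      left i j k i⪯j (j⪯k , j≢k) with i Fin.≟ j
      ... | yes ≡.refl = j⪯k
      ... | no i≢j = nonzero⇒⪯ {N} ((g ∙ h) ∙ g′)
          (normal g g′ h (T-inverse i≺j 1# (- 1#) (-‿inverseˡ 1#)) (∈UT-transvection {N} j≺k 1# N⊑R j⪯k))
          (trans (T-col′ i≺j (- 1#) k∈A (j≢k ∘ ≡.sym) λ m → entry (g ∙ h) i m)
          (trans (T-row i≺j 1# λ m → entry h m k)
          (trans (+-cong (T-0 j≺k 1# (i≢j ∘ proj₁) i≢k) (trans (*-identityˡ (entry h j k)) (T-at j≺k 1#)))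
          (+-identityˡ 1#))))
        where
        i≺j : _≺_ R i j
        i≺j = i⪯j , i≢j
        j≺k : _≺_ R j k
        j≺k = N⊑R j k j⪯k , j≢k
        i≢k : i ≢ k
        i≢k ≡.refl = i≢j (PO.antisym R i⪯j (proj₁ j≺k))
        k∈A = proj₂ (PO.support N j⪯k)
        g  = transvection i≺j 1#
        g′ = transvection i≺j (- 1#)
        h  = transvection j≺k 1#

      right : ∀ j k l → _≺_ N j k → _⪯_ R k l → _⪯_ N j l
      right j k l (j⪯k , j≢k) k⪯l with k Fin.≟ l
      ... | yes ≡.refl = j⪯k
      ... | no k≢l = nonzero⇒⪯ {N} ((g ∙ h) ∙ g′)
          (normal g g′ h (T-inverse k≺l (- 1#) 1# (-‿inverseʳ 1#)) (∈UT-transvection {N} j≺k 1# N⊑R j⪯k))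
          (trans (sum-cong-≋ λ m → *-congʳ (T-row′ k≺l (- 1#) j∈A j≢k λ t → entry h t m))
          (trans (T-row j≺k 1# λ m → entry g′ m l)
          (trans (+-cong (T-0 k≺l 1# (j≢k ∘ proj₁) j≢l) (trans (*-identityˡ (entry g′ k l)) (T-at k≺l 1#)))
          (+-identityˡ 1#))))
        where
        k≺l : _≺_ R k l
        k≺l = k⪯l , k≢l
        j≺k : _≺_ R j k
        j≺k = N⊑R j k j⪯k , j≢k
        j≢l : j ≢ l
        j≢l ≡.refl = j≢k (PO.antisym R (proj₁ j≺k) k⪯l)
        j∈A = proj₁ (PO.support N j⪯k)
        g  = transvection k≺l (- 1#)
        g′ = transvection k≺l 1#
        h  = transvection j≺k 1#

      ideal : ∀ i j k l → _⪯_ R i j → _≺_ N j k → _⪯_ R k l → _⪯_ N i l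
      ideal i j k l i⪯j j≺k@(_ , j≢k) k⪯l =
        right i k l (left i j k i⪯j j≺k , λ { ≡.refl → j≢k (PO.antisym R (N⊑R j k (proj₁ j≺k)) i⪯j) }) k⪯l

  -- Elements of UT_R lie in the same block of Cl(R) exactly when they
  -- lie in the same members of NPtt(R).

  module _ {n} {A : Subset n} {R : PO A} where

    ≤⇒⊑ : ∀ (M N : NPtt R) → M ≤ N → proj₁ M ⊑ proj₁ N
    ≤⇒⊑ (M , M⊑R , _) (N , _) M≤N i j i⪯j with i Fin.≟ j
    ... | yes ≡.refl = PO.refl N (proj₁ (PO.support M i⪯j))
    ... | no i≢j = nonzero⇒⪯ {R = R} {N = N} T (M≤N T (∈UT-transvection {R = R} {N = M} i≺j 1# M⊑R i⪯j)) (T-at {R = R} i≺j 1#)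
      where
      i≺j : _≺_ R i j
      i≺j = M⊑R i j i⪯j , i≢j
      T = transvection {R = R} i≺j 1#

    ⊑⇒≤ : ∀ (M N : NPtt R) → proj₁ M ⊑ proj₁ N → M ≤ N
    ⊑⇒≤ _ _ M⊑N u u∈M i j i⋠j = u∈M i j (i⋠j ∘ M⊑N i j)

    -- The smallest member of NPtt(R) containing g.
    hull : UT R → NPtt R
    hull g = H , ideal⇒normal (H⊑R , ideal)
      where
      _≼_ : Rel (Fin n) 0ℓ
      i ≼ l = (i ≡ l × i ∈ A) ⊎
        ∃ λ j → ∃ λ k → _⪯_ R i j × j ≢ k × False (entry g j k ≟ 0#) × _⪯_ R k l

      _≼?_ : Decidable _≼_
      i ≼? l = ((i Fin.≟ l) ×-dec (i ∈? A)) ⊎-dec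
        (any? λ j → any? λ k → (_⪯?_ R i j) ×-dec ((¬? (j Fin.≟ k)) ×-dec
          ((map′ fromWitnessFalse toWitnessFalse (¬? (entry g j k ≟ 0#))) ×-dec (_⪯?_ R k l))))

      ≼⇒⪯ : ∀ i l → i ≼ l → _⪯_ R i l
      ≼⇒⪯ i l (inj₁ (≡.refl , i∈A)) = PO.refl R i∈A
      ≼⇒⪯ i l (inj₂ (j , k , i⪯j , _ , g≉0 , k⪯l)) = PO.trans R i⪯j (PO.trans R
        (decidable-stable (_⪯?_ R j k) λ j⋠k → toWitnessFalse g≉0 (UT.support g j⋠k)) k⪯l)

      H : PO A
      H = record
        { _⪯_  = _≼_
        ; _⪯?_ = _≼?_
        ; isPartialOrderOn = record
          { support = λ p → PO.support R (≼⇒⪯ _ _ p)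
          ; refl    = λ i∈A → inj₁ (≡.refl , i∈A)
          ; antisym = λ p q → PO.antisym R (≼⇒⪯ _ _ p) (≼⇒⪯ _ _ q)
          ; trans   = λ
            { (inj₁ (≡.refl , _)) q → q
            ; (inj₂ (j , k , i⪯j , j≢k , g≉0 , k⪯l)) q →
                inj₂ (j , k , i⪯j , j≢k , g≉0 , PO.trans R k⪯l (≼⇒⪯ _ _ q))
            }
          }
        }

      H⊑R : H ⊑ R
      H⊑R = ≼⇒⪯

      ideal : ∀ i j k l → _⪯_ R i j → _≺_ H j k → _⪯_ R k l → _⪯_ H i l
      ideal i j k l i⪯j (inj₁ (j≡k , _) , j≢k) k⪯l = contradiction j≡k j≢k
      ideal i j k l i⪯j (inj₂ (a , b , j⪯a , a≢b , g≉0 , b⪯k) , _) k⪯l =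
        inj₂ (a , b , PO.trans R i⪯j j⪯a , a≢b , g≉0 , PO.trans R b⪯k k⪯l)

    ∈hull : ∀ g → g ∈UT proj₁ (hull g)
    ∈hull g i j i⋠j = decidable-stable (entry g i j ≟ 0#) λ g≉0 → go g≉0 (i Fin.≟ j)
      where
      i⪯j : ¬ entry g i j ≈ 0# → _⪯_ R i j
      i⪯j g≉0 = decidable-stable (_⪯?_ R i j) λ i⋠j → g≉0 (UT.support g i⋠j)

      go : ¬ entry g i j ≈ 0# → ¬ Dec (i ≡ j)
      go g≉0 (yes i≡j) = i⋠j (inj₁ (i≡j , proj₁ (PO.support R (i⪯j g≉0))))
      go g≉0 (no i≢j)  with i∈A , j∈A ← PO.support R (i⪯j g≉0) =
        i⋠j (inj₂ (i , j , PO.refl R i∈A , i≢j , fromWitnessFalse g≉0 , PO.refl R j∈A))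

    hull-least : ∀ g (N : NPtt R) → g ∈UT proj₁ N → hull g ≤ N
    hull-least g (N , N◁R) g∈N = ⊑⇒≤ (hull g) (N , N◁R) λ
      { i l (inj₁ (≡.refl , i∈A)) → PO.refl N i∈A
      ; i l (inj₂ (j , k , i⪯j , j≢k , g≉0 , k⪯l)) → proj₂ (normal⇒ideal N◁R) i j k l i⪯j
          (decidable-stable (_⪯?_ N j k) (λ j⋠k → toWitnessFalse g≉0 (g∈N j k j⋠k)) , j≢k) k⪯l
      }

    private
      pairs : PO A → Subset _
      pairs K = tabulate λ p → does (_⪯?_ K (quotient n p) (remainder {n} n p))

      pairs⁺ : ∀ K p → _⪯_ K (quotient n p) (remainder {n} n p) → p ∈ pairs K
      pairs⁺ K p k = lookup⇒[]= p _ (≡.trans (lookup∘tabulate _ p) (dec-true (_⪯?_ K _ _) k))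

      pairs⁻ : ∀ K p → p ∈ pairs K → _⪯_ K (quotient n p) (remainder {n} n p)
      pairs⁻ K p p∈ = decidable-stable (_⪯?_ K _ _) λ ¬k →
        case (≡.trans (≡.sym (dec-false (_⪯?_ K _ _) ¬k))
             (≡.trans (≡.sym (lookup∘tabulate _ p)) ([]=⇒lookup p∈)))
        where
        case : false ≡ true → ⊥
        case ()

      pairs-⊂ : ∀ (K L : NPtt R) → K < L → pairs (proj₁ K) ⊂ pairs (proj₁ L)
      pairs-⊂ K@(K′ , _) L@(L′ , _) (K≤L , L≰K) =
        (λ {p} p∈ → pairs⁺ L′ p (≤⇒⊑ K L K≤L _ _ (pairs⁻ K′ p p∈))) ,
        go (any? λ p → (p ∈? pairs L′) ×-dec ¬? (p ∈? pairs K′))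
        where
        go : Dec (∃ λ p → p ∈ pairs L′ × p ∉ pairs K′) → ∃ λ p → p ∈ pairs L′ × p ∉ pairs K′
        go (yes p) = p
        go (no ∄p) = contradiction (⊑⇒≤ L K L⊑K) L≰K
          where
          L⊑K : L′ ⊑ K′
          L⊑K i j i⪯j = decidable-stable (_⪯?_ K′ i j) λ i⋠j → ∄p (combine i j ,
            pairs⁺ L′ _ (≡.subst₂ (_⪯_ L′) (≡.sym q≡) (≡.sym r≡) i⪯j) ,
            λ p∈ → i⋠j (≡.subst₂ (_⪯_ K′) q≡ r≡ (pairs⁻ K′ _ p∈)))
            where
            q≡ : quotient n (combine i j) ≡ i
            q≡ = ≡.cong proj₁ (Fin.remQuot-combine {n} i j)
            r≡ : remainder {n} n (combine i j) ≡ j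
            r≡ = ≡.cong proj₂ (Fin.remQuot-combine {n} i j)

    ∈∘⇒minimal : ∀ g N → g ∈∘ N → ∀ K → g ∈UT proj₁ K → ¬ K < N
    ∈∘⇒minimal g N (_ , g∉) K = go K (⊃-wellFounded (pairs (proj₁ K)))
      where
      go : ∀ K → Acc _⊃_ (pairs (proj₁ K)) → g ∈UT proj₁ K → ¬ K < N
      go K (acc rs) g∈K K<N = g∉ K
        (K<N , λ L K<L L<N → go L (rs (pairs-⊂ K L K<L)) (proj₁ K<L g g∈K) L<N) g∈K

    sameBlock⇒ : ∀ {g h} → SameBlock g h → ∀ (M : NPtt R) → g ∈UT proj₁ M → h ∈UT proj₁ M
    sameBlock⇒ {g} {h} (both {N} g∈∘N h∈∘N) M g∈M = decidable-stable (h ∈UT? proj₁ M) λ h∉M →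
      ∈∘⇒minimal g N g∈∘N (hull g) (∈hull g)
        (hull-least g N (proj₁ g∈∘N) ,
         λ N≤hull → h∉M (hull-least g M g∈M h (N≤hull h (proj₁ h∈∘N))))

    ⇒sameBlock : ∀ {g h} → (∀ (M : NPtt R) → g ∈UT proj₁ M → h ∈UT proj₁ M) →
                 (∀ (M : NPtt R) → h ∈UT proj₁ M → g ∈UT proj₁ M) → SameBlock g h
    ⇒sameBlock {g} {h} g⇒h h⇒g = both {N = hull g}
      (∈hull g , λ M M⋖ g∈M → proj₂ (proj₁ M⋖) (hull-least g M g∈M))
      (g⇒h (hull g) (∈hull g) , λ M M⋖ h∈M → proj₂ (proj₁ M⋖) (hull-least g M (h⇒g M h∈M)))

    sameBlock-sym : ∀ {g h : UT R} → SameBlock g h → SameBlock h g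
    sameBlock-sym (both {N} g∈∘ h∈∘) = both {N = N} h∈∘ g∈∘

  -- Cl(R) as an equivalence relation on UT_R, namely to lie in the same block.
  Cl : PO A → Setoid (c ⊔ ℓ) (lsuc 0ℓ ⊔ c ⊔ ℓ)
  Cl R = record
    { Carrier       = UT R
    ; _≈_           = SameBlock
    ; isEquivalence = record
      { refl  = ⇒sameBlock (λ _ g∈ → g∈) (λ _ g∈ → g∈)
      ; sym   = sameBlock-sym
      ; trans = λ gh hk → ⇒sameBlock
          (λ M → sameBlock⇒ hk M ∘ sameBlock⇒ gh M)
          (λ M → sameBlock⇒ (sameBlock-sym gh) M ∘ sameBlock⇒ (sameBlock-sym hk) M)
      }
    }

  Cl* : ∀ {Is : List (Subset n)} → All PO Is → Setoid (c ⊔ ℓ) (lsuc 0ℓ ⊔ c ⊔ ℓ)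
  Cl* []       = Always.setoid Unit.⊤ _
  Cl* (R ∷ Rs) = ×-setoid (Cl R) (Cl* Rs)

  module _ {n} {A B : Subset n} (A#B : Disjoint A B) where

    private
      A⊆ : A ⊆ (A ∪ B)
      A⊆ = p⊆p∪q B
      B⊆ : B ⊆ (A ∪ B)
      B⊆ = q⊆p∪q A B

    -- The inclusion of UT_{P|_A} × UT_{P|_B} in UT_P: because entries are stored
    -- extended by zero, the block element (u , v) has the entries of u plus
    -- those of v.
    blockDiagonal : (P : PO (A ∪ B)) →
      Func (×-setoid (Cl (restrict P A (p⊆p∪q B))) (Cl (restrict P B (q⊆p∪q A B)))) (Cl P)
    blockDiagonal P = record
      { to   = uncurry _⊕_
      ; cong = λ (g~g′ , h~h′) → ⇒sameBlock (mono g~g′ h~h′) (mono (sameBlock-sym g~g′) (sameBlock-sym h~h′))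
      }
      where
      P|A = restrict P A A⊆
      P|B = restrict P B B⊆

      A-0 : (u : UT P|A) → ∀ {i j} → ¬ (i ∈ A × j ∈ A) → entry u i j ≈ 0#
      A-0 u ¬A = UT.support u λ (i∈A , j∈A , _) → ¬A (i∈A , j∈A)

      B-0 : (v : UT P|B) → ∀ {i j} → ¬ (i ∈ B × j ∈ B) → entry v i j ≈ 0#
      B-0 v ¬B = UT.support v λ (i∈B , j∈B , _) → ¬B (i∈B , j∈B)

      _⊕_ : UT P|A → UT P|B → UT P
      u ⊕ v = record
        { entry   = λ i j → entry u i j + entry v i j
        ; support = λ i⋠j → trans
            (+-cong (UT.support u λ (_ , _ , p) → i⋠j p) (UT.support v λ (_ , _ , p) → i⋠j p))
            (+-identityˡ 0#)
        ; unit    = unit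
        }
        where
        unit : ∀ {i} → i ∈ (A ∪ B) → entry u i i + entry v i i ≈ 1#
        unit i∈ with x∈p∪q⁻ A B i∈
        ... | inj₁ i∈A = trans (+-cong (UT.unit u i∈A) (B-0 v λ (i∈B , _) → clash A#B i∈A i∈B)) (+-identityʳ 1#)
        ... | inj₂ i∈B = trans (+-cong (A-0 u λ (i∈A , _) → clash A#B i∈A i∈B) (UT.unit v i∈B)) (+-identityˡ 1#)

      ⊕∈ : ∀ (M : PO (A ∪ B)) {u v} → u ∈UT restrict M A A⊆ → v ∈UT restrict M B B⊆ → (u ⊕ v) ∈UT M
      ⊕∈ M u∈ v∈ i j i⋠j = trans
        (+-cong (u∈ i j λ (_ , _ , m) → i⋠j m) (v∈ i j λ (_ , _ , m) → i⋠j m)) (+-identityˡ 0#)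

      ∈⊕₁ : ∀ (M : PO (A ∪ B)) {u v} → (u ⊕ v) ∈UT M → u ∈UT restrict M A A⊆
      ∈⊕₁ M {u} {v} uv∈ i j ¬m with (i ∈? A) ×-dec (j ∈? A)
      ... | no ¬A = A-0 u ¬A
      ... | yes (i∈A , j∈A) = trans (sym (trans
              (+-congˡ (B-0 v λ (i∈B , _) → clash A#B i∈A i∈B)) (+-identityʳ _)))
              (uv∈ i j λ m → ¬m (i∈A , j∈A , m))

      ∈⊕₂ : ∀ (M : PO (A ∪ B)) {u v} → (u ⊕ v) ∈UT M → v ∈UT restrict M B B⊆
      ∈⊕₂ M {u} {v} uv∈ i j ¬m with (i ∈? B) ×-dec (j ∈? B)
      ... | no ¬B = B-0 v ¬B
      ... | yes (i∈B , j∈B) = trans (sym (trans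
              (+-congʳ (A-0 u λ (i∈A , _) → clash A#B i∈A i∈B)) (+-identityˡ _)))
              (uv∈ i j λ m → ¬m (i∈B , j∈B , m))

      restrict-NPtt : NPtt P → ∀ C (C⊆ : C ⊆ (A ∪ B)) → NPtt (restrict P C C⊆)
      restrict-NPtt (M , M◁P) C C⊆ = restrict M C C⊆ ,
        ideal⇒normal (ideal-restrict {N = M} {P} {C⊆} (normal⇒ideal M◁P))

      mono : ∀ {u u′ v v′} → SameBlock u u′ → SameBlock v v′ →
             ∀ (M : NPtt P) → (u ⊕ v) ∈UT proj₁ M → (u′ ⊕ v′) ∈UT proj₁ M
      mono {u} {u′} {v} {v′} u~ v~ M uv∈ = ⊕∈ (proj₁ M) {u′} {v′}
        (sameBlock⇒ u~ (restrict-NPtt M A A⊆) (∈⊕₁ (proj₁ M) {u} {v} uv∈))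
        (sameBlock⇒ v~ (restrict-NPtt M B B⊆) (∈⊕₂ (proj₁ M) {u} {v} uv∈))

    -- u ↦ (u_A , u_B)
    split : (P : PO A) (Q : PO B) → Func (Cl (dot A#B P Q)) (×-setoid (Cl P) (Cl Q))
    split P Q = record
      { to   = λ u → u |A , u |B
      ; cong = λ u~v →
          ⇒sameBlock (mono₁ u~v) (mono₁ (sameBlock-sym u~v)) ,
          ⇒sameBlock (mono₂ u~v) (mono₂ (sameBlock-sym u~v))
      }
      where
      PQ = dot A#B P Q

      inA? : ∀ i j → Dec (i ∈ A × j ∈ A)
      inA? i j = (i ∈? A) ×-dec (j ∈? A)

      inB? : ∀ i j → Dec (i ∈ B × j ∈ B)
      inB? i j = (i ∈? B) ×-dec (j ∈? B)

      dotA : ∀ {M : PO A} {N : PO B} {i j} → i ∈ A × j ∈ A → _⪯_ (dot A#B M N) i j → _⪯_ M i j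
      dotA _           (inj₁ m)                = m
      dotA {N = N} (i∈A , _)   (inj₂ (inj₁ m)) = ⊥-elim (clash A#B i∈A (proj₁ (PO.support N m)))
      dotA (_   , j∈A) (inj₂ (inj₂ (_ , j∈B))) = ⊥-elim (clash A#B j∈A j∈B)

      dotB : ∀ {M : PO A} {N : PO B} {i j} → i ∈ B × j ∈ B → _⪯_ (dot A#B M N) i j → _⪯_ N i j
      dotB {M = M} (i∈B , _) (inj₁ m)          = ⊥-elim (clash A#B (proj₁ (PO.support M m)) i∈B)
      dotB _           (inj₂ (inj₁ m))         = m
      dotB (i∈B , _)   (inj₂ (inj₂ (i∈A , _))) = ⊥-elim (clash A#B i∈A i∈B)

      cut : ∀ {p} {X : Set p} (d : Dec X) {a : Carrier} → (X → a ≈ 0#) → (if does d then a else 0#) ≈ 0#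
      cut (yes x) a≈0 = a≈0 x
      cut (no _)  _   = refl

      _|A : UT PQ → UT P
      u |A = record
        { entry   = λ i j → if does (inA? i j) then entry u i j else 0#
        ; support = λ {i} {j} i⋠j → cut (inA? i j) λ ij∈A → UT.support u (i⋠j ∘ dotA {P} {Q} ij∈A)
        ; unit    = λ {i} i∈A → trans (reflexive (if-true (inA? i i) (i∈A , i∈A))) (UT.unit u (A⊆ i∈A))
        }

      _|B : UT PQ → UT Q
      u |B = record
        { entry   = λ i j → if does (inB? i j) then entry u i j else 0#
        ; support = λ {i} {j} i⋠j → cut (inB? i j) λ ij∈B → UT.support u (i⋠j ∘ dotB {P} {Q} ij∈B)
        ; unit    = λ {i} i∈B → trans (reflexive (if-true (inB? i i) (i∈B , i∈B))) (UT.unit u (B⊆ i∈B))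
        }

      mono₁ : ∀ {u v} → SameBlock u v → ∀ (M : NPtt P) → (u |A) ∈UT proj₁ M → (v |A) ∈UT proj₁ M
      mono₁ {u} {v} u~v (M , M◁P) u∈ i j i⋠j = cut (inA? i j) λ ij∈A →
        sameBlock⇒ u~v (MQ , ideal⇒normal ideal) u∈MQ i j (i⋠j ∘ dotA {M} {Q} ij∈A)
        where
        MQ = dot A#B M Q
        ideal : Ideal MQ PQ
        ideal = ideal-dot {A#B = A#B} {M} {P} {Q} {Q} (normal⇒ideal M◁P) (ideal-refl Q)

        u∈MQ : u ∈UT MQ
        u∈MQ x y x⋠y with _⪯?_ PQ x y
        ... | no ¬pq               = UT.support u ¬pq
        ... | yes (inj₂ r)         = contradiction (inj₂ r) x⋠y
        ... | yes (inj₁ p)         = trans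
          (reflexive (≡.sym (if-true (inA? x y) (PO.support P p)))) (u∈ x y (x⋠y ∘ inj₁))

      mono₂ : ∀ {u v} → SameBlock u v → ∀ (M : NPtt Q) → (u |B) ∈UT proj₁ M → (v |B) ∈UT proj₁ M
      mono₂ {u} {v} u~v (M , M◁Q) u∈ i j i⋠j = cut (inB? i j) λ ij∈B →
        sameBlock⇒ u~v (PM , ideal⇒normal ideal) u∈PM i j (i⋠j ∘ dotB {P} {M} ij∈B)
        where
        PM = dot A#B P M
        ideal : Ideal PM PQ
        ideal = ideal-dot {A#B = A#B} {P} {P} {M} {Q} (ideal-refl P) (normal⇒ideal M◁Q)

        u∈PM : u ∈UT PM
        u∈PM x y x⋠y with _⪯?_ PQ x y
        ... | no ¬pq               = UT.support u ¬pq
        ... | yes (inj₁ p)         = contradiction (inj₁ p) x⋠y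
        ... | yes (inj₂ (inj₂ r))  = contradiction (inj₂ (inj₂ r)) x⋠y
        ... | yes (inj₂ (inj₁ q))  = trans
          (reflexive (≡.sym (if-true (inB? x y) (PO.support Q q)))) (u∈ x y (x⋠y ∘ inj₂ ∘ inj₁))

  blockDiagonal* : ∀ {Is : List (Subset n)} → AllPairs Disjoint Is → (P : PO (⋃ Is)) →
                   Func (Cl* (restrict* Is P)) (Cl P)
  blockDiagonal* [] P = record { to = λ _ → ε ; cong = λ _ → Setoid.refl (Cl P) }
  blockDiagonal* {Is = I ∷ Is} (I# ∷ disj) P = record
    { to   = λ (u , us) → to block (u , to rest us)
    ; cong = λ (u~ , us~) → cong block (u~ , cong rest us~)
    }
    where
    open Func using (to; cong)
    block = blockDiagonal (disjoint-⋃ I#) P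
    rest  = blockDiagonal* disj (restrict P (⋃ Is) (q⊆p∪q I (⋃ Is)))

  split* : ∀ {Is : List (Subset n)} (disj : AllPairs Disjoint Is) (Ps : All PO Is) →
           Func (Cl (dot* disj Ps)) (Cl* Ps)
  split* []          []       = record { to = λ _ → _ ; cong = λ _ → _ }
  split* (I# ∷ disj) (P ∷ Ps) = record
    { to   = λ u → let u₁ , u₂ = to first u in u₁ , to rest u₂
    ; cong = λ u~v → let u~v₁ , u~v₂ = cong first u~v in u~v₁ , cong rest u~v₂
    }
    where
    open Func using (to; cong)
    first = split (disjoint-⋃ I#) P (dot* disj Ps)
    rest  = split* disj Ps

  rearrange-◁ : ∀ {Q P R : PO A} → Q ◁ R → ((I , _) : Factorization Q P) → P ◁ rearrange R I
  rearrange-◁ {Q = Q} {P} {R} Q◁R fac@(I , _) = ideal⇒normal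
    (ideal-≗ {N = rearrange Q I} {P} {rearrange R I} (factorization-≗ {Q = Q} {P} fac)
      (ideal-rearrange {N = Q} {R} I (normal⇒ideal Q◁R)))

-- The functions take values in a commutative ring K, of which the complex
-- numbers are an instance.
module HopfMonoid {c ℓ k ℓ′} (F : FiniteField c ℓ) (K : CommutativeRing k ℓ′) where

  open PatternGroup F public
  open Func using (to; cong)
  private
    module K = CommutativeRing K
  open Exp K.semiring using (_^_)

  -- f(UT_R; Cl(R)), where the congruence field of a Func says that the
  -- function is constant on the blocks
  f : PO A → Set _
  f R = Func (Cl R) K.setoid

  -- An element of ⨁_R f(UT_R; Cl(R)) is presented as a formal sum of
  -- functions, each in the summand of the order R it is paired with.
  ptt : Subset n → Set _
  ptt A = List (∃ λ (R : PO A) → f R)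

  evaluate : ∀ {R : PO A} → UT R → ∀ {P} → f P → Dec (P ≗ R) → K.Carrier
  evaluate u φ (yes (_ , R⊑P)) = to φ (extend R⊑P u)
  evaluate u φ (no _)          = K.0#

  -- The value at u of the component of x in the summand of R.
  component : ptt A → (R : PO A) → UT R → K.Carrier
  component x R u = foldr (λ (P , φ) s → evaluate u φ (P ≗? R) K.+ s) K.0# x

  infix 4 _≃_
  _≃_ : ptt A → ptt A → Set _
  x ≃ y = ∀ R u → component x R u K.≈ component y R u

  infixr 7 _·_
  scale : ∀ {R : PO A} → K.Carrier → f R → f R
  scale a φ = record { to = λ u → a K.* to φ u ; cong = λ u~v → K.*-congˡ (cong φ u~v) }

  _·_ : K.Carrier → ptt A → ptt A
  a · x = map (λ (R , φ) → R , scale a φ) x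

  -- ptt[I₁] ⊗ ⋯ ⊗ ptt[Iₗ], with f(UT_{R₁}; Cl(R₁)) ⊗ ⋯ ⊗ f(UT_{Rₗ}; Cl(Rₗ))
  -- identified with the functions on UT_{R₁} × ⋯ × UT_{Rₗ} constant on
  -- products of blocks
  Tensor : List (Subset n) → Set _
  Tensor Is = List (∃ λ (Rs : All PO Is) → Func (Cl* Rs) K.setoid)

  -- Iterated coproduct and product.  On a summand, Δ_{I₁,…,Iₗ} is
  -- (id ⊗ Δ_{I₂,…,Iₗ}) ∘ Δ_{I₁,I₂∪⋯∪Iₗ}: restriction along the iterated
  -- block diagonal inclusion; dually, m_{I₁,…,Iₗ} is inflation along the
  -- iterated splitting.  For l = 0 these are the counit and the unit.
  Δ : ∀ {Is : List (Subset n)} → AllPairs Disjoint Is → ptt (⋃ Is) → Tensor Is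
  Δ {Is = Is} disj = map λ (P , φ) → restrict* Is P , Composition.function (blockDiagonal* disj P) φ

  m : ∀ {Is : List (Subset n)} → AllPairs Disjoint Is → Tensor Is → ptt (⋃ Is)
  m disj = map λ (Rs , θ) → dot* disj Rs , Composition.function (split* disj Rs) θ

  m∘Δ : SetComposition A → ptt A → ptt A
  m∘Δ (_ , record { covers = ≡.refl ; disjoint = disj }) x = m disj (Δ disj x)

  -- (-1)^{l-1}, written so as to make sense also for l = 0
  sign : ℕ → K.Carrier
  sign l = (K.- K.1#) ^ suc l

  antipode : ptt A → ptt A
  antipode {A = A} x = concatMap (λ I → sign (length (blocks I)) · m∘Δ I x) (compositions A)

  [_]? : ∀ {x} {X : Set x} → Dec X → K.Carrier
  [ X? ]? = if does X? then K.1# else K.0#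

  []?-cong : ∀ {x y} {X : Set x} {Y : Set y} (X? : Dec X) (Y? : Dec Y) →
             (X → Y) → (Y → X) → [ X? ]? K.≈ [ Y? ]?
  []?-cong (yes _) (yes _) _   _   = K.refl
  []?-cong (no _)  (no _)  _   _   = K.refl
  []?-cong (yes x) (no ¬y) x⇒y _   = contradiction (x⇒y x) ¬y
  []?-cong (no ¬x) (yes y) _   y⇒x = contradiction (y⇒x y) ¬x

  -- δ_{UT_Q} as an element of f(UT_R; Cl(R)).
  indicator : (Q R : PO A) → Q ◁ R → f R
  indicator Q R Q◁R = record
    { to   = λ u → [ u ∈UT? Q ]?
    ; cong = λ {u} {v} u~v → []?-cong (u ∈UT? Q) (v ∈UT? Q)
        (sameBlock⇒ u~v (Q , Q◁R)) (sameBlock⇒ (sameBlock-sym u~v) (Q , Q◁R))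
    }

  δ : (Q R : PO A) → Q ◁ R → ptt A
  δ Q R Q◁R = (R , indicator Q R Q◁R) ∷ []

  -- (-1)^{l-1} δ_{UT_P} in the summand of R|_{I₁} . ⋯ . R|_{Iₗ} if the
  -- list, to be taken as Fac Q P, consists of a single (I₁ , … , Iₗ)
  signedδ : (Q R : PO A) → Q ◁ R → (P : PO A) → List (Factorization Q P) → ptt A
  signedδ Q R Q◁R P (fac@(I , _) ∷ []) =
    sign (length (blocks I)) · δ P (rearrange R I) (rearrange-◁ {Q = Q} {P} {R} Q◁R fac)
  signedδ Q R Q◁R P _ = []

{-# OPTIONS --safe #-}
-- Restricting δ_{UT_Q} along I = (I₁,…,Iₗ) and inflating back gives the indicator
-- of UT_P in the summand of R|_{I₁}.⋯.R|_{Iₗ}, where P = Q|_{I₁}.⋯.Q|_{Iₗ} is the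
-- one order that has I as a Q-factorization.  So the terms of Takeuchi's formula
-- may be collected by P.  For a fixed P they agree up to the sign (-1)^{l-1}; in
-- particular R|_{I₁}.⋯.R|_{Iₗ} does not depend on I.  If P has two
-- Q-factorizations, then some block of one of them is divided by a block boundary
-- D of the other.  There every Q-factorization of P may be cut, if a block
-- straddles D, or glued, if none does, and this involution changes l by one, so
-- that all terms belonging to P cancel.
module Submission where

open import Defs
open import Algebra.Bundles using (CommutativeMonoid; CommutativeRing)
import Algebra.Properties.CommutativeSemigroup as CommutativeSemigroupProperties
import Algebra.Properties.Ring as RingProperties
open import Data.Bool.Base using (true; false; if_then_else_)
open import Data.Empty using (⊥-elim)
open import Data.Fin.Base using (Fin)
open import Data.Fin.Properties as Fin using ()
open import Data.Fin.Subset using (Subset; _∈_; _∉_; _⊆_; _∩_; _∪_; ∁; ∣_∣; ⋃; Nonempty)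
open import Data.Fin.Subset.Properties
  using (_∈?_; nonempty?; ∪-assoc; ∪-inverseʳ; ∩-distribˡ-∪; ∩-identityʳ; p∩q⊆p; p∩q⊆q; p⊆p∪q; q⊆p∪q;
         x∈p∪q⁻; x∈p∩q⁺; x∈p∩q⁻; ∉⊥; x∈∁p⇒x∉p; x∉p⇒x∈∁p; ⊆-antisym; p⊂q⇒∣p∣<∣q∣; ∣p∣≤n)
open import Data.List.Base using (List; []; _∷_; [_]; _++_; length; map; foldr; filter; concatMap; upTo)
open import Data.List.Membership.Propositional using () renaming (_∈_ to _∈ₗ_)
open import Data.List.Membership.Propositional.Properties
  using (∈-map⁺; ∈-map⁻; ∈-filter⁺; ∈-concatMap⁺; ∈-cartesianProductWith⁺; ∈-upTo⁺; ∈-∃++)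
open import Data.List.Properties using (foldr-map)
import Data.List.Relation.Binary.Disjoint.Propositional as List
open import Data.List.Relation.Binary.Permutation.Propositional as ↭ using (_↭_; ↭-sym)
open import Data.List.Relation.Binary.Permutation.Propositional.Properties
  using (∈-resp-↭; All-resp-↭; ↭-length; shift)
open import Data.List.Relation.Binary.Permutation.Setoid.Properties using (Unique-resp-↭)
open import Data.List.Relation.Unary.All as All using (All; []; _∷_)
import Data.List.Relation.Unary.All.Properties as All
open import Data.List.Relation.Unary.AllPairs as AllPairs using (AllPairs; []; _∷_)
import Data.List.Relation.Unary.AllPairs.Properties as AllPairs
open import Data.List.Relation.Unary.Any as Any using (Any; here; there)
open import Data.List.Relation.Unary.Linked using (Linked; []; [-]; _∷_)
open import Data.List.Relation.Unary.Unique.Propositional using (Unique)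
import Data.List.Relation.Unary.Unique.Propositional.Properties as Unique
open import Data.Nat.Base using (ℕ; zero; suc; _≤_; z≤n; s≤s)
import Data.Nat.Properties as ℕ
open import Data.Product.Base using (∃; _×_; _,_; proj₁; proj₂)
open import Data.Sum.Base using (_⊎_; inj₁; inj₂)
open import Data.Vec.Base using (Vec; []; _∷_; lookup; tabulate; toList; fromList)
import Data.Vec.Properties as Vec
open import Function.Base using (_∘_)
open import Function.Bundles using (Func)
import Function.Construct.Composition as Composition
open import Level using (Level; 0ℓ)
open import Relation.Binary.Core using (Rel)
open import Relation.Binary.Definitions using (Decidable)
open import Relation.Binary.PropositionalEquality as ≡ using (_≡_; _≢_; refl)
import Relation.Binary.Reasoning.Setoid as SetoidReasoning
open import Relation.Nullary.Decidable
  using (Dec; yes; no; does; dec-true; dec-false; _×-dec_; ¬?; decidable-stable)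
open import Relation.Nullary.Negation using (¬_; contradiction)

open PO using (_⪯_; _⪯?_; _≺_)
open IsSetComposition

-- Cutting is harmless: if P and Q agree on a block, they agree on its parts. Gluing is the
-- obstacle, since P stacks two adjacent blocks while Q may leave them incomparable or order them
-- otherwise. Hence D cannot be an arbitrary boundary. It is taken where two factorizations of P
-- first differ, so that it runs through a block on which P and Q agree. That block supplies
-- relations of Q across D, and transitivity of Q carries them over to every other factorization of
-- P that has a boundary at D. That the summand does not depend on I rests on Q ⊑ R: inside a block
-- P is then contained in R, and between different blocks P alone decides.

private
  variable
    n : ℕ
    A : Subset n
    Is Js Ks : List (Subset n)

-- Subsets and strict orders

⊆⊎∉ : (X Y : Subset n) → X ⊆ Y ⊎ ∃ λ x → x ∈ X × x ∉ Y
⊆⊎∉ X Y with Fin.any? (λ x → (x ∈? X) ×-dec ¬? (x ∈? Y))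
... | yes ∃x = inj₂ ∃x
... | no ∄x  = inj₁ λ {x} x∈X → decidable-stable (x ∈? Y) λ x∉Y → ∄x (x , x∈X , x∉Y)

∪-cancelˡ : {X Y Z : Subset n} → Disjoint X Y → Disjoint X Z → X ∪ Y ≡ X ∪ Z → Y ≡ Z
∪-cancelˡ X#Y X#Z eq = ⊆-antisym (half X#Y eq) (half X#Z (≡.sym eq))
  where
  half : ∀ {X Y Z : Subset _} → Disjoint X Y → X ∪ Y ≡ X ∪ Z → Y ⊆ Z
  half {X} {Y} {Z} X#Y eq y∈Y with x∈p∪q⁻ X Z (≡.subst (_ ∈_) eq (q⊆p∪q X Y y∈Y))
  ... | inj₁ y∈X = ⊥-elim (clash X#Y y∈X y∈Y)
  ... | inj₂ y∈Z = y∈Z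

module _ (P : PO A) where

  ≺⇒⋡ : ∀ {x y} → _≺_ P x y → ¬ _⪯_ P y x
  ≺⇒⋡ (x⪯y , x≢y) y⪯x = x≢y (PO.antisym P x⪯y y⪯x)

  ≺-asym : ∀ {x y} → _≺_ P x y → ¬ _≺_ P y x
  ≺-asym x≺y (y⪯x , _) = ≺⇒⋡ x≺y y⪯x

-- Ordinal sums of restricted orders

-- The order of Q|_{I₁} . ⋯ . Q|_{Iₗ}, for Q an arbitrary relation.
data Arranged {n} (ρ : Rel (Fin n) 0ℓ) : List (Subset n) → Rel (Fin n) 0ℓ where
  within : ∀ {X Xs i j} → i ∈ X → j ∈ X → ρ i j → Arranged ρ (X ∷ Xs) i j
  across : ∀ {X Xs i j} → i ∈ X → j ∈ ⋃ Xs → Arranged ρ (X ∷ Xs) i j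
  later  : ∀ {X Xs i j} → Arranged ρ Xs i j → Arranged ρ (X ∷ Xs) i j

Arranged-support : ∀ {ρ : Rel (Fin n) 0ℓ} {i j} → Arranged ρ Is i j → i ∈ ⋃ Is × j ∈ ⋃ Is
Arranged-support (within i∈X j∈X _) = p⊆p∪q _ i∈X , p⊆p∪q _ j∈X
Arranged-support (across i∈X j∈Xs)  = p⊆p∪q _ i∈X , q⊆p∪q _ _ j∈Xs
Arranged-support (later a) with i∈ , j∈ ← Arranged-support a = q⊆p∪q _ _ i∈ , q⊆p∪q _ _ j∈

-- The recursion replaces `R` by its restrictions to smaller and smaller unions while `ρ` stays
-- fixed; only an inclusion between the two is assumed, and it survives the restriction.
dot*⇒Arranged : ∀ {ρ : Rel (Fin n) 0ℓ} (disj : AllPairs Disjoint Is) (R : PO (⋃ Is)) →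
                (∀ {i j} → _⪯_ R i j → ρ i j) →
                ∀ {i j} → _⪯_ (dot* disj (restrict* Is R)) i j → Arranged ρ Is i j
dot*⇒Arranged (_ ∷ disj) R R⇒ρ (inj₁ (i∈ , j∈ , r))    = within i∈ j∈ (R⇒ρ r)
dot*⇒Arranged (_ ∷ disj) R R⇒ρ (inj₂ (inj₁ r))         =
  later (dot*⇒Arranged disj _ (λ (_ , _ , r) → R⇒ρ r) r)
dot*⇒Arranged (_ ∷ disj) R R⇒ρ (inj₂ (inj₂ (i∈ , j∈))) = across i∈ j∈

Arranged⇒dot* : ∀ {ρ : Rel (Fin n) 0ℓ} (disj : AllPairs Disjoint Is) (R : PO (⋃ Is)) →
                (∀ {i j} → i ∈ ⋃ Is → j ∈ ⋃ Is → ρ i j → _⪯_ R i j) →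
                ∀ {i j} → Arranged ρ Is i j → _⪯_ (dot* disj (restrict* Is R)) i j
Arranged⇒dot* (_ ∷ disj) R ρ⇒R (within i∈ j∈ r) = inj₁ (i∈ , j∈ , ρ⇒R (p⊆p∪q _ i∈) (p⊆p∪q _ j∈) r)
Arranged⇒dot* (_ ∷ disj) R ρ⇒R (across i∈ j∈)   = inj₂ (inj₂ (i∈ , j∈))
Arranged⇒dot* (_ ∷ disj) R ρ⇒R (later a)        =
  inj₂ (inj₁ (Arranged⇒dot* disj _ (λ i∈ j∈ r → i∈ , j∈ , ρ⇒R (q⊆p∪q _ _ i∈) (q⊆p∪q _ _ j∈) r) a))

rearrange⇒Arranged : (R : PO A) (I : SetComposition A) →
                     ∀ {i j} → _⪯_ (rearrange R I) i j → Arranged (_⪯_ R) (blocks I) i j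
rearrange⇒Arranged R (_ , record { covers = refl ; disjoint = disj }) = dot*⇒Arranged disj R λ r → r

Arranged⇒rearrange : (R : PO A) (I : SetComposition A) →
                     ∀ {i j} → Arranged (_⪯_ R) (blocks I) i j → _⪯_ (rearrange R I) i j
Arranged⇒rearrange R (_ , record { covers = refl ; disjoint = disj }) = Arranged⇒dot* disj R λ _ _ r → r

-- Factorizations as splittings

-- An equivalent of Q-factorization suited to recursion over the blocks.

module _ {n} {A : Subset n} (P Q : PO A) where

  infixr 5 _∷_

  record Summand (X C : Subset n) : Set where
    constructor summand
    field
      nonempty : Nonempty X
      agree    : Agree P Q X
      precedes : ∀ {x y} → x ∈ X → y ∈ C → _≺_ P x y

  data Splitting : List (Subset n) → Set where
    []  : Splitting []
    _∷_ : ∀ {X Xs} → Summand X (⋃ Xs) → Splitting Xs → Splitting (X ∷ Xs)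

  open Summand

  summand-disjoint : ∀ {X C} → Summand X C → Disjoint X C
  summand-disjoint s (i , i∈) with i∈X , i∈C ← x∈p∩q⁻ _ _ i∈ = proj₂ (precedes s i∈X i∈C) refl

  -- Passing from extremal elements of adjacent blocks to all elements of all later blocks is
  -- `below-⋃`; strictness comes from disjointness.
  factorization⇒splitting : IsSetComposition A Is → IsFactorization Q P Is → Splitting Is
  factorization⇒splitting c f = go (λ x∈ → ≡.subst (_ ∈_) (covers c) x∈) (nonempty c) (disjoint c)
    (IsFactorization.agree f) (IsFactorization.below f)
    where
    go : ∀ {Is} → ⋃ Is ⊆ A → All Nonempty Is → AllPairs Disjoint Is →
         All (Agree P Q) Is → Linked (Below P) Is → Splitting Is
    go sub []        []           []       lnk = []
    go {I ∷ Is} sub (ne ∷ nes) (I# ∷ disj) (a ∷ as) lnk =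
      summand ne a (λ x∈ y∈ → below-⋃ P sub nes lnk _ _ x∈ y∈ ,
                     λ { refl → clash (disjoint-⋃ I#) x∈ y∈ }) ∷
      go (λ x∈ → sub (q⊆p∪q I (⋃ Is) x∈)) nes disj as (linked-tail lnk)

  splitting⇒nonempty : Splitting Is → All Nonempty Is
  splitting⇒nonempty []      = []
  splitting⇒nonempty (s ∷ g) = nonempty s ∷ splitting⇒nonempty g

  splitting⇒composition : Splitting Is → ⋃ Is ≡ A → IsSetComposition A Is
  splitting⇒composition g cov = record { covers = cov ; nonempty = splitting⇒nonempty g ; disjoint = disj g }
    where
    disjoint⁻ : ∀ {X : Subset n} Xs → Disjoint X (⋃ Xs) → All (Disjoint X) Xs
    disjoint⁻ []       _ = []
    disjoint⁻ {X} (Y ∷ Ys) d =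
      (λ (i , i∈) → let i∈X , i∈Y = x∈p∩q⁻ X Y i∈ in clash d i∈X (p⊆p∪q _ i∈Y)) ∷
      disjoint⁻ Ys (λ (i , i∈) → let i∈X , i∈Ys = x∈p∩q⁻ X (⋃ Ys) i∈ in clash d i∈X (q⊆p∪q Y _ i∈Ys))
    disj : ∀ {Is} → Splitting Is → AllPairs Disjoint Is
    disj []      = []
    disj (s ∷ g) = disjoint⁻ _ (summand-disjoint s) ∷ disj g

  splitting⇒factorization : Splitting Is → ⋃ Is ≡ A → IsFactorization Q P Is
  splitting⇒factorization g refl = record { agree = agrees g ; convex = convex g inj₁ ; below = below g }
    where
    agrees : ∀ {Is} → Splitting Is → All (Agree P Q) Is
    agrees []      = []
    agrees (s ∷ g) = agree s ∷ agrees g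

    below : ∀ {Is} → Splitting Is → Linked (Below P) Is
    below []           = []
    below (_ ∷ [])     = [-]
    below (s ∷ t ∷ g)  = (λ x y (x∈ , _) (y∈ , _) → precedes s x∈ (p⊆p∪q _ y∈)) ∷ below (t ∷ g)

    -- The cover hypothesis says that an element of `A` outside the remaining blocks lies strictly
    -- below all of them. So an element between two elements of a block can be in neither an earlier
    -- nor a later block.
    convex : ∀ {Is} → Splitting Is →
             (∀ {y} → y ∈ A → y ∈ ⋃ Is ⊎ (∀ {x} → x ∈ ⋃ Is → _≺_ P y x)) → All (Convex P) Is
    convex [] _ = []
    convex {X ∷ Xs} (s ∷ g) cover = convexX ∷ convex g cover′
      where
      convexX : Convex P X
      convexX x y z x∈X z∈X x≺y y≺z with cover (proj₂ (PO.support P (proj₁ x≺y)))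
      ... | inj₂ y≺ = ⊥-elim (≺-asym P x≺y (y≺ (p⊆p∪q _ x∈X)))
      ... | inj₁ y∈ with x∈p∪q⁻ X (⋃ Xs) y∈
      ...   | inj₁ y∈X  = y∈X
      ...   | inj₂ y∈Xs = ⊥-elim (≺-asym P y≺z (precedes s z∈X y∈Xs))

      cover′ : ∀ {y} → y ∈ A → y ∈ ⋃ Xs ⊎ (∀ {x} → x ∈ ⋃ Xs → _≺_ P y x)
      cover′ y∈A with cover y∈A
      ... | inj₂ y≺ = inj₂ λ x∈ → y≺ (q⊆p∪q X _ x∈)
      ... | inj₁ y∈ with x∈p∪q⁻ X (⋃ Xs) y∈
      ...   | inj₁ y∈X  = inj₂ (precedes s y∈X)
      ...   | inj₂ y∈Xs = inj₁ y∈Xs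

  -- As the blocks are disjoint, the positions of `i` and `j` determine which constructor of
  -- `Arranged` applies, so the comparison with `P` can be read off block by block.
  arranged⇒splitting : All Nonempty Is → AllPairs Disjoint Is →
    (∀ {i j} → i ∈ ⋃ Is → j ∈ ⋃ Is → _⪯_ P i j → Arranged (_⪯_ Q) Is i j) →
    (∀ {i j} → Arranged (_⪯_ Q) Is i j → _⪯_ P i j) → Splitting Is
  arranged⇒splitting []         []       _   _   = []
  arranged⇒splitting {X ∷ Xs} (ne ∷ nes) (d ∷ ds) P⇒Q Q⇒P =
    summand ne
      (λ i j i∈ j∈ → (λ p → unwithin i∈ j∈ (P⇒Q (p⊆p∪q _ i∈) (p⊆p∪q _ j∈) p)) , λ q → Q⇒P (within i∈ j∈ q))
      (λ x∈ y∈ → Q⇒P (across x∈ y∈) , λ { refl → clash X# x∈ y∈ }) ∷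
    arranged⇒splitting nes ds
      (λ i∈ j∈ p → unlater i∈ (P⇒Q (q⊆p∪q _ _ i∈) (q⊆p∪q _ _ j∈) p)) (λ q → Q⇒P (later q))
    where
    X# = disjoint-⋃ d
    unwithin : ∀ {i j} → i ∈ X → j ∈ X → Arranged (_⪯_ Q) (X ∷ Xs) i j → _⪯_ Q i j
    unwithin i∈ j∈ (within _ _ q) = q
    unwithin i∈ j∈ (across _ j∈′) = ⊥-elim (clash X# j∈ j∈′)
    unwithin i∈ j∈ (later a)      = ⊥-elim (clash X# i∈ (proj₁ (Arranged-support a)))
    unlater : ∀ {i j} → i ∈ ⋃ Xs → Arranged (_⪯_ Q) (X ∷ Xs) i j → Arranged (_⪯_ Q) Xs i j
    unlater i∈ (within i∈′ _ _) = ⊥-elim (clash X# i∈′ i∈)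
    unlater i∈ (across i∈′ _)   = ⊥-elim (clash X# i∈′ i∈)
    unlater i∈ (later a)        = a

  -- The order R|_{I₁} . ⋯ . R|_{Iₗ} in terms that do not involve the blocks.

  module _ {R : PO A} (Q⊑R : Q ⊑ R) where

    Mixed : Rel (Fin n) 0ℓ
    Mixed i j = _⪯_ P i j ⊎ (_⪯_ R i j × ¬ _⪯_ P j i)

    -- Inside a block `P` agrees with `Q` and is therefore contained in `R`. If `i ⪯ j` in `R` and
    -- `j ⪯ i` in `P`, antisymmetry of `R` leaves only `i ≡ j`.
    Arranged⇒Mixed : Splitting Is → ∀ {i j} → Arranged (_⪯_ R) Is i j → Mixed i j
    Arranged⇒Mixed (s ∷ g) (across i∈ j∈)   = inj₁ (proj₁ (precedes s i∈ j∈))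
    Arranged⇒Mixed (s ∷ g) (later a)        = Arranged⇒Mixed g a
    Arranged⇒Mixed (s ∷ g) {i} {j} (within i∈ j∈ r) with _⪯?_ P j i
    ... | no  j⋠i = inj₂ (r , j⋠i)
    ... | yes j⪯i with refl ← PO.antisym R r (Q⊑R j i (proj₁ (agree s j i j∈ i∈) j⪯i)) = inj₁ j⪯i

    Mixed⇒Arranged : Splitting Is → ∀ {i j} → i ∈ ⋃ Is → j ∈ ⋃ Is → Mixed i j → Arranged (_⪯_ R) Is i j
    Mixed⇒Arranged [] i∈ _ _ = ⊥-elim (∉⊥ i∈)
    Mixed⇒Arranged {X ∷ Xs} (s ∷ g) {i} {j} i∈ j∈ m with x∈p∪q⁻ X (⋃ Xs) i∈ | x∈p∪q⁻ X (⋃ Xs) j∈ | m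
    ... | inj₁ i∈X  | inj₁ j∈X  | inj₁ p       = within i∈X j∈X (Q⊑R i j (proj₁ (agree s i j i∈X j∈X) p))
    ... | inj₁ i∈X  | inj₁ j∈X  | inj₂ (r , _) = within i∈X j∈X r
    ... | inj₁ i∈X  | inj₂ j∈Xs | _            = across i∈X j∈Xs
    ... | inj₂ i∈Xs | inj₁ j∈X  | inj₁ p       = ⊥-elim (≺⇒⋡ P (precedes s j∈X i∈Xs) p)
    ... | inj₂ i∈Xs | inj₁ j∈X  | inj₂ (_ , ¬p) = ⊥-elim (¬p (proj₁ (precedes s j∈X i∈Xs)))
    ... | inj₂ i∈Xs | inj₂ j∈Xs | m            = later (Mixed⇒Arranged g i∈Xs j∈Xs m)

    rearrange-⊑ : ∀ (I J : SetComposition A) → Splitting (blocks I) → Splitting (blocks J) →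
                  rearrange R I ⊑ rearrange R J
    rearrange-⊑ I J gI gJ i j r with i∈A , j∈A ← PO.support (rearrange R I) r =
      Arranged⇒rearrange R J (Mixed⇒Arranged gJ (in-blocks i∈A) (in-blocks j∈A)
        (Arranged⇒Mixed gI (rearrange⇒Arranged R I r)))
      where
      in-blocks : A ⊆ ⋃ (blocks J)
      in-blocks = ≡.subst (_ ∈_) (≡.sym (covers (proj₂ J)))

  -- A boundary at which two splittings differ

  -- D is the lower part of an ordinal sum decomposition of P|_C.  In any
  -- Q-factorization of P|_C with a boundary at D, the blocks on both sides of it
  -- are stacked in Q too: if x and y lie in these blocks, then tight puts z in the
  -- block of x and w in that of y, where P agrees with Q.
  record Cut (C D : Subset n) : Set where
    field
      inside  : ∃ λ x → x ∈ C × x ∈ D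
      outside : ∃ λ y → y ∈ C × y ∉ D
      down    : ∀ {x y} → x ∈ C → x ∈ D → y ∈ C → y ∉ D → _≺_ P x y
      tight   : ∀ {x y} → x ∈ C → x ∈ D → y ∈ C → y ∉ D → ∃ λ z → ∃ λ w →
                (z ∈ C × z ∈ D) × (w ∈ C × w ∉ D) × _⪯_ P x z × _⪯_ Q z w × _⪯_ P w y

  open Cut

  -- Since `Y` sticks out of `X`, the end of `X` runs through the block `Y`, and there relations of
  -- `P` across the boundary are relations of `Q`.
  first-block-cut : ∀ {X Xs Y Ys} → Splitting (X ∷ Xs) → Splitting (Y ∷ Ys) → X ∪ ⋃ Xs ≡ Y ∪ ⋃ Ys →
                    (∃ λ w → w ∈ Y × w ∉ X) → Cut (X ∪ ⋃ Xs) X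
  first-block-cut {X} {Xs} {Y} {Ys} (s ∷ g) (t ∷ h) eq (w , w∈Y , w∉X) = record
    { inside  = proj₁ (nonempty s) , p⊆p∪q _ (proj₂ (nonempty s)) , proj₂ (nonempty s)
    ; outside = w , w∈C , w∉X
    ; down    = λ _ x∈X y∈C y∉X → precedes s x∈X (rest y∈C y∉X)
    ; tight   = tight′
    }
    where
    C = X ∪ ⋃ Xs
    rest : ∀ {y} → y ∈ C → y ∉ X → y ∈ ⋃ Xs
    rest y∈C y∉X with x∈p∪q⁻ X (⋃ Xs) y∈C
    ... | inj₁ y∈X  = ⊥-elim (y∉X y∈X)
    ... | inj₂ y∈Xs = y∈Xs

    w∈C : w ∈ C
    w∈C = ≡.subst (w ∈_) (≡.sym eq) (p⊆p∪q _ w∈Y)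

    -- An element of `X` outside `Y` would be above `w` by the second splitting and below `w` by the
    -- first.
    X⊆Y : X ⊆ Y
    X⊆Y {x} x∈X with x∈p∪q⁻ Y (⋃ Ys) (≡.subst (x ∈_) eq (p⊆p∪q _ x∈X))
    ... | inj₁ x∈Y  = x∈Y
    ... | inj₂ x∈Ys = ⊥-elim (≺-asym P (precedes t w∈Y x∈Ys) (precedes s x∈X (rest w∈C w∉X)))

    to-Q : ∀ {x y} → x ∈ X → y ∈ Y → y ∈ C → y ∉ X → _⪯_ Q x y
    to-Q {x} {y} x∈X y∈Y y∈C y∉X = proj₁ (agree t x y (X⊆Y x∈X) y∈Y) (proj₁ (precedes s x∈X (rest y∈C y∉X)))

    tight′ : ∀ {x y} → x ∈ C → x ∈ X → y ∈ C → y ∉ X → ∃ λ z → ∃ λ v →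
             (z ∈ C × z ∈ X) × (v ∈ C × v ∉ X) × _⪯_ P x z × _⪯_ Q z v × _⪯_ P v y
    tight′ {x} {y} x∈C x∈X y∈C y∉X with precedes s x∈X (rest y∈C y∉X) | x∈p∪q⁻ Y (⋃ Ys) (≡.subst (y ∈_) eq y∈C)
    ... | x≺y | inj₁ y∈Y  = x , y , (x∈C , x∈X) , (y∈C , y∉X) , PO.refl P (proj₁ (PO.support P (proj₁ x≺y))) ,
                        to-Q x∈X y∈Y y∈C y∉X , PO.refl P (proj₂ (PO.support P (proj₁ x≺y)))
    -- Here `y` lies beyond `Y`, so `w`, which is in `Y` and below `y`, takes its place as the upper
    -- witness.
    ... | x≺y | inj₂ y∈Ys = x , w , (x∈C , x∈X) , (w∈C , w∉X) , PO.refl P (proj₁ (PO.support P (proj₁ x≺y))) ,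
                        to-Q x∈X w∈Y w∈C w∉X , proj₁ (precedes t w∈Y y∈Ys)

  cut-∪ : ∀ {X C D} → Summand X C → Cut C D → Cut (X ∪ C) (X ∪ D)
  cut-∪ {X} {C} {D} s c = record
    { inside  = let x , x∈C , x∈D = inside c in x , q⊆p∪q X C x∈C , q⊆p∪q X D x∈D
    ; outside = let y , y∈C , y∉D = outside c in y , q⊆p∪q X C y∈C , λ y∈ → outside∉ y∈C y∉D y∈
    ; down    = down′
    ; tight   = tight′
    }
    where
    outside∉ : ∀ {y} → y ∈ C → y ∉ D → y ∉ X ∪ D
    outside∉ y∈C y∉D y∈ with x∈p∪q⁻ X D y∈
    ... | inj₁ y∈X = clash (summand-disjoint s) y∈X y∈C
    ... | inj₂ y∈D = y∉D y∈D

    upper : ∀ {y} → y ∈ X ∪ C → y ∉ X ∪ D → y ∈ C × y ∉ D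
    upper y∈ y∉ with x∈p∪q⁻ X C y∈
    ... | inj₁ y∈X = ⊥-elim (y∉ (p⊆p∪q D y∈X))
    ... | inj₂ y∈C = y∈C , λ y∈D → y∉ (q⊆p∪q X D y∈D)

    lower : ∀ {x} → x ∈ X ∪ C → x ∈ X ∪ D → x ∈ X ⊎ x ∈ C × x ∈ D
    lower x∈ x∈′ with x∈p∪q⁻ X C x∈ | x∈p∪q⁻ X D x∈′
    ... | inj₁ x∈X | _        = inj₁ x∈X
    ... | inj₂ _   | inj₁ x∈X = inj₁ x∈X
    ... | inj₂ x∈C | inj₂ x∈D = inj₂ (x∈C , x∈D)

    down′ : ∀ {x y} → x ∈ X ∪ C → x ∈ X ∪ D → y ∈ X ∪ C → y ∉ X ∪ D → _≺_ P x y
    down′ x∈ x∈′ y∈ y∉ with lower x∈ x∈′ | upper y∈ y∉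
    ... | inj₁ x∈X         | y∈C , _   = precedes s x∈X y∈C
    ... | inj₂ (x∈C , x∈D) | y∈C , y∉D = down c x∈C x∈D y∈C y∉D

    lift : ∀ {x y} → (∃ λ z → ∃ λ w →
           (z ∈ C × z ∈ D) × (w ∈ C × w ∉ D) × _⪯_ P x z × _⪯_ Q z w × _⪯_ P w y) → ∃ λ z → ∃ λ w →
           (z ∈ X ∪ C × z ∈ X ∪ D) × (w ∈ X ∪ C × w ∉ X ∪ D) × _⪯_ P x z × _⪯_ Q z w × _⪯_ P w y
    lift (z , w , (z∈C , z∈D) , (w∈C , w∉D) , rest) =
      z , w , (q⊆p∪q X C z∈C , q⊆p∪q X D z∈D) , (q⊆p∪q X C w∈C , outside∉ w∈C w∉D) , rest

    tight′ : ∀ {x y} → x ∈ X ∪ C → x ∈ X ∪ D → y ∈ X ∪ C → y ∉ X ∪ D → ∃ λ z → ∃ λ w →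
             (z ∈ X ∪ C × z ∈ X ∪ D) × (w ∈ X ∪ C × w ∉ X ∪ D) × _⪯_ P x z × _⪯_ Q z w × _⪯_ P w y
    tight′ x∈ x∈′ y∈ y∉ with lower x∈ x∈′ | upper y∈ y∉ | inside c
    ... | inj₂ (x∈C , x∈D) | y∈C , y∉D | _ = lift (tight c x∈C x∈D y∈C y∉D)
    -- An `x` in the new block borrows the witnesses of an element `d` of `C` inside `D`, because
    -- `x` is below `d`.
    ... | inj₁ x∈X         | y∈C , y∉D | d , d∈C , d∈D
        with z , w , z∈ , w∈ , d⪯z , rest ← tight c d∈C d∈D y∈C y∉D =
        lift (z , w , z∈ , w∈ , PO.trans P (proj₁ (precedes s x∈X d∈C)) d⪯z , rest)

  -- Equal first blocks are stripped and later added to `D`. At the first difference one block has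
  -- an element outside the other, and the other provides the boundary.
  equal-or-cut : Splitting Is → Splitting Js → ⋃ Is ≡ ⋃ Js → Is ≡ Js ⊎ ∃ (Cut (⋃ Is))
  equal-or-cut [] [] _ = inj₁ refl
  equal-or-cut [] (t ∷ h) eq with y , y∈Y ← nonempty t = ⊥-elim (∉⊥ (≡.subst (y ∈_) (≡.sym eq) (p⊆p∪q _ y∈Y)))
  equal-or-cut (s ∷ g) [] eq with x , x∈X ← nonempty s = ⊥-elim (∉⊥ (≡.subst (x ∈_) eq (p⊆p∪q _ x∈X)))
  equal-or-cut {X ∷ Xs} {Y ∷ Ys} (s ∷ g) (t ∷ h) eq with ⊆⊎∉ Y X | ⊆⊎∉ X Y
  ... | inj₂ w    | _         = inj₂ (X , first-block-cut (s ∷ g) (t ∷ h) eq w)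
  ... | inj₁ _    | inj₂ w    =
        inj₂ (Y , ≡.subst (λ C → Cut C Y) (≡.sym eq) (first-block-cut (t ∷ h) (s ∷ g) (≡.sym eq) w))
  ... | inj₁ Y⊆X  | inj₁ X⊆Y  with refl ← ⊆-antisym X⊆Y Y⊆X
      with equal-or-cut g h (∪-cancelˡ (summand-disjoint s) (summand-disjoint t) eq)
  ...   | inj₁ refl    = inj₁ refl
  ...   | inj₂ (D , c) = inj₂ (X ∪ D , cut-∪ s c)

-- Cutting and gluing as a matching of block lists

-- Merge D Is Js: the blocks of Js are those of Is, except that the last block
-- inside D and the first one outside D are united.
data Merge {n} (D : Subset n) : Rel (List (Subset n)) 0ℓ where
  here  : ∀ {X Y Z Xs} → X ⊆ D → Disjoint Y D → X ∪ Y ≡ Z → Merge D (X ∷ Y ∷ Xs) (Z ∷ Xs)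
  there : ∀ {Z Xs Ys} → Z ⊆ D → Merge D Xs Ys → Merge D (Z ∷ Xs) (Z ∷ Ys)

nonempty-meets : {X D : Subset n} → Nonempty X → X ⊆ D → ¬ Disjoint X D
nonempty-meets (x , x∈X) X⊆D X#D = clash X#D x∈X (X⊆D x∈X)

∪≡⇒⊆ˡ : {X Y Z : Subset n} → X ∪ Y ≡ Z → X ⊆ Z
∪≡⇒⊆ˡ refl = p⊆p∪q _

∪≡⇒⊆ʳ : {X Y Z : Subset n} → X ∪ Y ≡ Z → Y ⊆ Z
∪≡⇒⊆ʳ {X = X} refl = q⊆p∪q X _

module _ {D : Subset n} where

  merge-⋃ : Merge D Is Js → ⋃ Is ≡ ⋃ Js
  merge-⋃ (here {X} {Y} {Xs = Xs} _ _ refl) = ≡.sym (∪-assoc X Y (⋃ Xs))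
  merge-⋃ (there {Z} _ m)     = ≡.cong (Z ∪_) (merge-⋃ m)

  merge-length : Merge D Is Js → length Is ≡ suc (length Js)
  merge-length (here _ _ _)  = refl
  merge-length (there _ m) = ≡.cong suc (merge-length m)

  -- A nonempty block cannot be both inside `D` and disjoint from `D`, so the place of the merge is
  -- forced.
  merge-functional : All Nonempty Is → Merge D Is Js → Merge D Is Ks → Js ≡ Ks
  merge-functional _ (here _ _ refl) (here _ _ refl) = refl
  merge-functional (_ ∷ ne ∷ _) (here _ Y#D _) (there _ (here Y⊆D _ _)) = ⊥-elim (nonempty-meets ne Y⊆D Y#D)
  merge-functional (_ ∷ ne ∷ _) (here _ Y#D _) (there _ (there Y⊆D _))  = ⊥-elim (nonempty-meets ne Y⊆D Y#D)
  merge-functional (_ ∷ ne ∷ _) (there _ (here Y⊆D _ _)) (here _ Y#D _) = ⊥-elim (nonempty-meets ne Y⊆D Y#D)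
  merge-functional (_ ∷ ne ∷ _) (there _ (there Y⊆D _)) (here _ Y#D _)  = ⊥-elim (nonempty-meets ne Y⊆D Y#D)
  merge-functional (_ ∷ nes) (there {Z} _ m) (there _ m′) = ≡.cong (Z ∷_) (merge-functional nes m m′)

  -- The two parts are recovered from the merged block as its intersections with `D` and with the
  -- complement of `D`.
  merge-injective : All Nonempty Is → All Nonempty Js → Merge D Is Ks → Merge D Js Ks → Is ≡ Js
  merge-injective _ _ (here {X} {Y} X⊆D Y#D eq) (here {X′} {Y′} X′⊆D Y′#D eq′) =
    ≡.cong₂ (λ U V → U ∷ V ∷ _)
      (⊆-antisym (lower X⊆D Y′#D (≡.trans eq (≡.sym eq′))) (lower X′⊆D Y#D (≡.trans eq′ (≡.sym eq))))
      (⊆-antisym (upper Y#D X′⊆D (≡.trans eq (≡.sym eq′))) (upper Y′#D X⊆D (≡.trans eq′ (≡.sym eq))))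
    where
    lower : ∀ {U V U′ V′ : Subset n} → U ⊆ D → Disjoint V′ D → U ∪ V ≡ U′ ∪ V′ → U ⊆ U′
    lower {U′ = U′} {V′} U⊆D V′#D eq x∈U with x∈p∪q⁻ U′ V′ (∪≡⇒⊆ˡ eq x∈U)
    ... | inj₁ x∈U′ = x∈U′
    ... | inj₂ x∈V′ = ⊥-elim (clash V′#D x∈V′ (U⊆D x∈U))
    upper : ∀ {U V U′ V′ : Subset n} → Disjoint V D → U′ ⊆ D → U ∪ V ≡ U′ ∪ V′ → V ⊆ V′
    upper {U′ = U′} {V′} V#D U′⊆D eq x∈V with x∈p∪q⁻ U′ V′ (∪≡⇒⊆ʳ eq x∈V)
    ... | inj₁ x∈U′ = ⊥-elim (clash V#D x∈V (U′⊆D x∈U′))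
    ... | inj₂ x∈V′ = x∈V′
  merge-injective (_ ∷ ne ∷ _) _ (here _ Y#D eq) (there Z⊆D _) = ⊥-elim (nonempty-meets ne (Z⊆D ∘ ∪≡⇒⊆ʳ eq) Y#D)
  merge-injective _ (_ ∷ ne ∷ _) (there Z⊆D _) (here _ Y#D eq) = ⊥-elim (nonempty-meets ne (Z⊆D ∘ ∪≡⇒⊆ʳ eq) Y#D)
  merge-injective (_ ∷ nes) (_ ∷ nes′) (there {Z} _ m) (there _ m′) = ≡.cong (Z ∷_) (merge-injective nes nes′ m m′)

  -- The merged block straddles `D`, whereas a second merge would require it to be inside `D` or
  -- disjoint from `D`. So no list can be both the result of a gluing and open to one.
  merge-¬merge : All Nonempty Is → Merge D Is Js → ¬ Merge D Js Ks
  merge-¬merge (_ ∷ ne ∷ _) (here _ Y#D eq) (here Z⊆D _ _) = nonempty-meets ne (Z⊆D ∘ ∪≡⇒⊆ʳ eq) Y#D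
  merge-¬merge (_ ∷ ne ∷ _) (here _ Y#D eq) (there Z⊆D _)  = nonempty-meets ne (Z⊆D ∘ ∪≡⇒⊆ʳ eq) Y#D
  merge-¬merge (_ ∷ nes) (there _ m) (there _ m′) = merge-¬merge nes m m′
  merge-¬merge (_ ∷ (x , x∈X) ∷ _) (there _ (here X⊆D _ eq)) (here _ Z#D _) = clash Z#D (∪≡⇒⊆ˡ eq x∈X) (X⊆D x∈X)
  merge-¬merge (_ ∷ ne ∷ _) (there _ (there Z⊆D _)) (here _ Z#D _) = nonempty-meets ne Z⊆D Z#D

  Partner : Rel (List (Subset n)) 0ℓ
  Partner Is Js = Merge D Is Js ⊎ Merge D Js Is

  partner-sym : Partner Is Js → Partner Js Is
  partner-sym (inj₁ m) = inj₂ m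
  partner-sym (inj₂ m) = inj₁ m

  partner-⋃ : Partner Is Js → ⋃ Is ≡ ⋃ Js
  partner-⋃ (inj₁ m) = merge-⋃ m
  partner-⋃ (inj₂ m) = ≡.sym (merge-⋃ m)

  partner-irrefl : All Nonempty Is → ¬ Partner Is Is
  partner-irrefl ne (inj₁ m) = merge-¬merge ne m m
  partner-irrefl ne (inj₂ m) = merge-¬merge ne m m

  partner-functional : All Nonempty Is → All Nonempty Js → All Nonempty Ks →
                       Partner Is Js → Partner Is Ks → Js ≡ Ks
  partner-functional i j k (inj₁ m) (inj₁ m′) = merge-functional i m m′
  partner-functional i j k (inj₁ m) (inj₂ m′) = ⊥-elim (merge-¬merge k m′ m)
  partner-functional i j k (inj₂ m) (inj₁ m′) = ⊥-elim (merge-¬merge j m m′)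
  partner-functional i j k (inj₂ m) (inj₂ m′) = merge-injective j k m m′

-- Every splitting has a partner

module _ {n} {A : Subset n} (P Q : PO A) {D : Subset n} where

  open Summand
  open Cut

  agree-∪ : ∀ {X Y} → Agree P Q X → Agree P Q Y → (∀ {x y} → x ∈ X → y ∈ Y → _≺_ P x y) →
            (∀ {x y} → x ∈ X → y ∈ Y → _⪯_ Q x y) → Agree P Q (X ∪ Y)
  agree-∪ {X} {Y} aX aY P≺ Q⪯ i j i∈ j∈ with x∈p∪q⁻ X Y i∈ | x∈p∪q⁻ X Y j∈
  ... | inj₁ i∈X | inj₁ j∈X = aX i j i∈X j∈X
  ... | inj₂ i∈Y | inj₂ j∈Y = aY i j i∈Y j∈Y
  ... | inj₁ i∈X | inj₂ j∈Y = (λ _ → Q⪯ i∈X j∈Y) , λ _ → proj₁ (P≺ i∈X j∈Y)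
  ... | inj₂ i∈Y | inj₁ j∈X =
    (λ p → ⊥-elim (≺⇒⋡ P (P≺ j∈X i∈Y) p)) ,
    (λ q → ⊥-elim (proj₂ (P≺ j∈X i∈Y) (PO.antisym Q (Q⪯ j∈X i∈Y) q)))

  -- The witness `z` of `tight` survives the removal of `X`: it is above some `x` in `C`, while
  -- everything in `X` is strictly below `x`.
  cut-tail : ∀ {X C} → Summand P Q X C → X ⊆ D → (∃ λ x → x ∈ C × x ∈ D) →
             Cut P Q (X ∪ C) D → Cut P Q C D
  cut-tail {X} {C} s X⊆D in′ c = record
    { inside  = in′
    ; outside = let y , y∈ , y∉D = outside c in y , above y∈ y∉D , y∉D
    ; down    = λ x∈ x∈D y∈ y∉D → down c (C⊆ x∈) x∈D (C⊆ y∈) y∉D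
    ; tight   = tight′
    }
    where
    C⊆ : C ⊆ X ∪ C
    C⊆ = q⊆p∪q X C
    above : ∀ {y} → y ∈ X ∪ C → y ∉ D → y ∈ C
    above y∈ y∉D with x∈p∪q⁻ X C y∈
    ... | inj₁ y∈X = ⊥-elim (y∉D (X⊆D y∈X))
    ... | inj₂ y∈C = y∈C
    tight′ : ∀ {x y} → x ∈ C → x ∈ D → y ∈ C → y ∉ D → ∃ λ z → ∃ λ w →
             (z ∈ C × z ∈ D) × (w ∈ C × w ∉ D) × _⪯_ P x z × _⪯_ Q z w × _⪯_ P w y
    tight′ x∈ x∈D y∈ y∉D
      with z , w , (z∈ , z∈D) , (w∈ , w∉D) , x⪯z , rest ← tight c (C⊆ x∈) x∈D (C⊆ y∈) y∉D
      with x∈p∪q⁻ X C z∈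
    ... | inj₁ z∈X = ⊥-elim (≺⇒⋡ P (precedes s z∈X x∈) x⪯z)
    ... | inj₂ z∈C = z , w , (z∈C , z∈D) , (above w∈ w∉D , w∉D) , x⪯z , rest

  split-summand : ∀ {X C} → Summand P Q X C → (∃ λ w → w ∈ X × w ∉ D) → Cut P Q (X ∪ C) D →
                  Summand P Q (X ∩ D) ((X ∩ ∁ D) ∪ C) × Summand P Q (X ∩ ∁ D) C
  split-summand {X} {C} s (w , w∈X , w∉D) c =
    summand (d , x∈p∩q⁺ (d∈X (x∈p∪q⁻ X C d∈) , d∈D)) (shrink (p∩q⊆p X D)) precedes₁ ,
    summand (w , x∈p∩q⁺ (w∈X , x∉p⇒x∈∁p w∉D)) (shrink (p∩q⊆p X (∁ D)))
      (λ x∈ y∈ → precedes s (p∩q⊆p X (∁ D) x∈) y∈)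
    where
    d   = proj₁ (inside c)
    d∈  = proj₁ (proj₂ (inside c))
    d∈D = proj₂ (proj₂ (inside c))

    d∈X : d ∈ X ⊎ d ∈ C → d ∈ X
    d∈X (inj₁ d∈X) = d∈X
    -- If `d` were in a later block, it would be above `w` by the splitting and below `w` by the
    -- cut, so the block that leaves `D` also meets `D`.
    d∈X (inj₂ d∈C) = ⊥-elim (≺-asym P (precedes s w∈X d∈C) (down c d∈ d∈D (p⊆p∪q C w∈X) w∉D))

    shrink : ∀ {Y} → Y ⊆ X → Agree P Q Y
    shrink Y⊆X i j i∈ j∈ = agree s i j (Y⊆X i∈) (Y⊆X j∈)

    precedes₁ : ∀ {x y} → x ∈ X ∩ D → y ∈ (X ∩ ∁ D) ∪ C → _≺_ P x y
    precedes₁ x∈ y∈ with x∈X , x∈D ← x∈p∩q⁻ X D x∈ with x∈p∪q⁻ (X ∩ ∁ D) C y∈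
    ... | inj₂ y∈C = precedes s x∈X y∈C
    ... | inj₁ y∈X with y∈X , y∈∁D ← x∈p∩q⁻ X (∁ D) y∈X =
          down c (p⊆p∪q C x∈X) x∈D (p⊆p∪q C y∈X) (x∈∁p⇒x∉p y∈∁D)

  merge-summands : ∀ {X Y C} → Summand P Q X (Y ∪ C) → Summand P Q Y C → X ⊆ D → Disjoint Y D →
                   Cut P Q (X ∪ (Y ∪ C)) D → Summand P Q (X ∪ Y) C
  merge-summands {X} {Y} {C} s t X⊆D Y#D c = summand
    (let x , x∈X = nonempty s in x , p⊆p∪q Y x∈X)
    (agree-∪ (agree s) (agree t) (λ x∈ y∈ → precedes s x∈ (p⊆p∪q C y∈)) stacked)
    precedes′
    where
    precedes′ : ∀ {x y} → x ∈ X ∪ Y → y ∈ C → _≺_ P x y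
    precedes′ x∈ y∈ with x∈p∪q⁻ X Y x∈
    ... | inj₁ x∈X = precedes s x∈X (q⊆p∪q Y C y∈)
    ... | inj₂ x∈Y = precedes t x∈Y y∈

    ∈Y : ∀ {y} → y ∈ Y → y ∈ X ∪ (Y ∪ C)
    ∈Y y∈Y = q⊆p∪q X (Y ∪ C) (p⊆p∪q C y∈Y)

    Y∌ : ∀ {y} → y ∈ Y → y ∉ D
    Y∌ = clash Y#D

    split∈ : ∀ {z} → z ∈ X ∪ (Y ∪ C) → z ∈ X ⊎ z ∈ Y ⊎ z ∈ C
    split∈ z∈ with x∈p∪q⁻ X (Y ∪ C) z∈
    ... | inj₁ z∈X = inj₁ z∈X
    ... | inj₂ z∈′ = inj₂ (x∈p∪q⁻ Y C z∈′)

    stacked : ∀ {x y} → x ∈ X → y ∈ Y → _⪯_ Q x y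
    stacked {x} {y} x∈X y∈Y
      with z , w , (z∈ , z∈D) , (w∈ , w∉D) , x⪯z , z⪯w , w⪯y ←
             tight c (p⊆p∪q (Y ∪ C) x∈X) (X⊆D x∈X) (∈Y y∈Y) (Y∌ y∈Y)
      with split∈ z∈ | split∈ w∈
    -- It remains to rule out the wrong blocks. A `z` beyond `Y` would be above `y`, although the
    -- cut puts it below `y`; a `w` beyond `Y` would be strictly above `y`, contrary to `w ⪯ y`.
    ... | inj₂ (inj₁ z∈Y) | _ = ⊥-elim (Y∌ z∈Y z∈D)
    ... | inj₂ (inj₂ z∈C) | _ = ⊥-elim (≺-asym P (precedes t y∈Y z∈C) (down c z∈ z∈D (∈Y y∈Y) (Y∌ y∈Y)))
    ... | inj₁ z∈X | inj₁ w∈X        = ⊥-elim (w∉D (X⊆D w∈X))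
    ... | inj₁ z∈X | inj₂ (inj₂ w∈C) = ⊥-elim (≺⇒⋡ P (precedes t y∈Y w∈C) w⪯y)
    ... | inj₁ z∈X | inj₂ (inj₁ w∈Y) = PO.trans Q (proj₁ (agree s x z x∈X z∈X) x⪯z)
                                         (PO.trans Q z⪯w (proj₁ (agree t w y w∈Y y∈Y) w⪯y))

  HasPartner : List (Subset n) → Set
  HasPartner Is = ∃ λ Js → Partner {D = D} Is Js × Splitting P Q Js

  partner : Splitting P Q Is → Cut P Q (⋃ Is) D → HasPartner Is
  partner [] c = ⊥-elim (∉⊥ (proj₁ (proj₂ (inside c))))
  partner (s ∷ g) c = step s g c (partner g)
    where
    step : ∀ {X Xs} → Summand P Q X (⋃ Xs) → Splitting P Q Xs → Cut P Q (X ∪ ⋃ Xs) D →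
           (Cut P Q (⋃ Xs) D → HasPartner Xs) → HasPartner (X ∷ Xs)
    step {X} {Xs} s g c rec with ⊆⊎∉ X D
    -- All blocks before this one were inside `D`, so this is the block that straddles the boundary,
    -- and it is cut.
    step {X} {Xs} s g c rec | inj₂ w with s₁ , s₂ ← split-summand s w c =
      _ , inj₂ (here (p∩q⊆q X D) upper#D rejoin) , s₁ ∷ s₂ ∷ g
      where
      upper#D : Disjoint (X ∩ ∁ D) D
      upper#D (i , i∈) with i∈X , i∈D ← x∈p∩q⁻ _ D i∈ = x∈∁p⇒x∉p (p∩q⊆q X (∁ D) i∈X) i∈D
      rejoin : (X ∩ D) ∪ (X ∩ ∁ D) ≡ X
      rejoin = ≡.trans (≡.sym (∩-distribˡ-∪ X D (∁ D)))
                 (≡.trans (≡.cong (X ∩_) (∪-inverseʳ D)) (∩-identityʳ X))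
    step {X} {[]} s [] c rec | inj₁ X⊆D with y , y∈ , y∉D ← outside c with x∈p∪q⁻ X (⋃ []) y∈
    ... | inj₁ y∈X = ⊥-elim (y∉D (X⊆D y∈X))
    ... | inj₂ y∈⊥ = ⊥-elim (∉⊥ y∈⊥)
    -- If `Y` misses `D`, the boundary falls between `X` and `Y`, which are glued. Otherwise it lies
    -- in or after `Y`, and `X` is kept.
    step {X} {Y ∷ Ys} s (t ∷ g) c rec | inj₁ X⊆D with nonempty? (Y ∩ D)
    ... | no Y#D = _ , inj₁ (here X⊆D Y#D refl) , merge-summands s t X⊆D Y#D c ∷ g
    ... | yes (d , d∈) with d∈Y , d∈D ← x∈p∩q⁻ Y D d∈
        with Js , m , h ← rec (cut-tail s X⊆D (d , p⊆p∪q (⋃ Ys) d∈Y , d∈D) c) =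
      X ∷ Js , lift m , summand (nonempty s) (agree s)
        (λ x∈ y∈ → precedes s x∈ (≡.subst (_ ∈_) (≡.sym (partner-⋃ m)) y∈)) ∷ h
      where
      lift : Partner {D = D} (Y ∷ Ys) Js → Partner {D = D} (X ∷ Y ∷ Ys) (X ∷ Js)
      lift (inj₁ m) = inj₁ (there X⊆D m)
      lift (inj₂ m) = inj₂ (there X⊆D m)

-- Enumerations of set compositions and orders

map-proj₁-select : ∀ {x p} {X : Set x} {P : X → Set p} (P? : ∀ x → Dec (P x)) xs →
                   map proj₁ (select P? xs) ≡ filter P? xs
map-proj₁-select P? []       = refl
map-proj₁-select P? (x ∷ xs) with P? x
... | yes _ = ≡.cong (x ∷_) (map-proj₁-select P? xs)
... | no _  = map-proj₁-select P? xs

module _ {x p} {X : Set x} {P : X → Set p} (P? : ∀ x → Dec (P x)) where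

  select-complete : ∀ {xs x} → x ∈ₗ xs → P x → ∃ λ y → y ∈ₗ select P? xs × x ≡ proj₁ y
  select-complete {xs} x∈xs px = ∈-map⁻ proj₁
    (≡.subst (_ ∈ₗ_) (≡.sym (map-proj₁-select P? xs)) (∈-filter⁺ P? x∈xs px))

  select-allPairs : ∀ {r} {R : Rel X r} {xs} → AllPairs R xs →
                    AllPairs (λ x y → R (proj₁ x) (proj₁ y)) (select P? xs)
  select-allPairs {R = R} {xs} rs = AllPairs.map⁻
    (≡.subst (AllPairs R) (≡.sym (map-proj₁-select P? xs)) (AllPairs.filter⁺ P? rs))

vectors-unique : ∀ {x} {X : Set x} {xs : List X} → Unique xs → ∀ m → Unique (vectors xs m)
vectors-unique u zero    = [] ∷ []
vectors-unique u (suc m) = Unique.cartesianProductWith⁺ _∷_ Vec.∷-injective u (vectors-unique u m)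

vectors-complete : ∀ {x} {X : Set x} {xs : List X} → (∀ x → x ∈ₗ xs) → ∀ {m} (v : Vec X m) → v ∈ₗ vectors xs m
vectors-complete all []      = here refl
vectors-complete all (x ∷ v) = ∈-cartesianProductWith⁺ _∷_ (all x) (vectors-complete all v)

subsets-unique : ∀ n → Unique (subsets n)
subsets-unique = vectors-unique (((λ ()) ∷ []) ∷ ([] ∷ []))

subsets-complete : (A : Subset n) → A ∈ₗ subsets n
subsets-complete = vectors-complete λ { true → here refl ; false → there (here refl) }

blockLists-unique : ∀ n → Unique (blockLists n)
blockLists-unique n = Unique.concat⁺
  (All.map⁺ (All.universal unique (upTo (suc n))))
  (AllPairs.map⁺ {f = blockListsOfLength} (AllPairs.map disjoint≢ (Unique.upTo⁺ (suc n))))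
  where
  blockListsOfLength : ℕ → List (List (Subset n))
  blockListsOfLength l = map toList (vectors (subsets n) l)
  unique : ∀ l → Unique (blockListsOfLength l)
  unique l = Unique.map⁺
    (λ {v} {w} eq → ≡.trans (≡.sym (Vec.cast-is-id refl v)) (Vec.toList-injective refl v w eq))
    (vectors-unique (subsets-unique n) l)
  length≡ : ∀ {l Is} → Is ∈ₗ blockListsOfLength l → length Is ≡ l
  length≡ Is∈ with v , _ , refl ← ∈-map⁻ toList Is∈ = Vec.length-toList v
  disjoint≢ : ∀ {l m} → l ≢ m → List.Disjoint (blockListsOfLength l) (blockListsOfLength m)
  disjoint≢ l≢m (∈l , ∈m) = l≢m (≡.trans (≡.sym (length≡ ∈l)) (length≡ ∈m))

blockLists-complete : {Is : List (Subset n)} → length Is ≤ n → Is ∈ₗ blockLists n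
blockLists-complete {n} {Is} l≤n = ∈-concatMap⁺ (λ l → map toList (vectors (subsets n) l))
  (Any.map (λ { refl → ≡.subst (_∈ₗ map toList (vectors (subsets n) (length Is))) (Vec.toList∘fromList Is)
                   (∈-map⁺ toList (vectors-complete subsets-complete (fromList Is))) })
    (∈-upTo⁺ (s≤s l≤n)))

-- Each block contributes an element that no later block contains; this justifies the length bound
-- built into `blockLists`.
length≤∣⋃∣ : All Nonempty Is → AllPairs Disjoint Is → length Is ≤ ∣ ⋃ Is ∣
length≤∣⋃∣ [] [] = z≤n
length≤∣⋃∣ {Is = I ∷ Is} ((i , i∈I) ∷ ne) (I# ∷ disj) = ℕ.≤-<-trans (length≤∣⋃∣ ne disj)
  (p⊂q⇒∣p∣<∣q∣ (q⊆p∪q I (⋃ Is) , i , p⊆p∪q (⋃ Is) i∈I , clash (disjoint-⋃ I#) i∈I))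

compositions-complete : IsSetComposition A Is → ∃ λ I → I ∈ₗ compositions A × Is ≡ blocks I
compositions-complete {A = A} {Is} c = select-complete (isSetComposition? A)
  (blockLists-complete (ℕ.≤-trans (length≤∣⋃∣ (nonempty c) (disjoint c)) (∣p∣≤n (⋃ Is)))) c

-- Factorizations are compared by their blocks, since the accompanying proofs need not be provably
-- equal.
facBlocks : {P Q : PO A} → List (Factorization Q P) → List (List (Subset _))
facBlocks = map (blocks ∘ proj₁)

module _ {n} {A : Subset n} (Q P : PO A) where

  Fac-unique : Unique (facBlocks (Fac Q P))
  Fac-unique = AllPairs.map⁺ (select-allPairs (λ I → isFactorization? Q P (blocks I))
    (select-allPairs (isSetComposition? A) (blockLists-unique n)))

  Fac-complete : IsSetComposition A Is → IsFactorization Q P Is → Is ∈ₗ facBlocks (Fac Q P)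
  Fac-complete c f
    with I , I∈ , refl ← compositions-complete c
    with J , J∈ , refl ← select-complete (λ I → isFactorization? Q P (blocks I)) I∈ f
    = ∈-map⁺ (blocks ∘ proj₁) J∈

≗-sym : {P Q : PO A} → P ≗ Q → Q ≗ P
≗-sym (P⊑Q , Q⊑P) = Q⊑P , P⊑Q

≗-trans : {P Q R : PO A} → P ≗ Q → Q ≗ R → P ≗ R
≗-trans (P⊑Q , Q⊑P) (Q⊑R , R⊑Q) =
  (λ i j → Q⊑R i j ∘ P⊑Q i j) , λ i j → Q⊑P i j ∘ R⊑Q i j

lookup-ext : ∀ {x} {X : Set x} {m} {v w : Vec X m} → (∀ i → lookup v i ≡ lookup w i) → v ≡ w
lookup-ext {v = v} {w} eq =
  ≡.trans (≡.sym (Vec.tabulate∘lookup v)) (≡.trans (Vec.tabulate-cong eq) (Vec.tabulate∘lookup w))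

posets-distinct : AllPairs (λ P Q → ¬ P ≗ Q) (posets A)
posets-distinct {n} {A} = AllPairs.map⁺ (AllPairs.map (λ M≢N (M⊑N , N⊑M) → M≢N
    (lookup-ext λ i → ⊆-antisym (λ {j} → M⊑N i j) (λ {j} → N⊑M i j)))
  (select-allPairs (λ M → isPartialOrderOn? A (relation? M)) (vectors-unique (subsets-unique n) n)))

posets-complete : (P : PO A) → Any (_≗ P) (posets A)
posets-complete {n} {A} P = Any.map ≗P (∈-map⁺ fromMatrix (proj₁ (proj₂ found)))
  where
  matrix : Matrix n
  matrix = tabulate λ i → tabulate λ j → does (_⪯?_ P i j)
  entry≡ : ∀ i j → lookup (lookup matrix i) j ≡ does (_⪯?_ P i j)
  entry≡ i j = ≡.trans (≡.cong (λ row → lookup row j) (Vec.lookup∘tabulate _ i)) (Vec.lookup∘tabulate _ j)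
  ⇒ : ∀ i j → relation matrix i j → _⪯_ P i j
  ⇒ i j j∈ with _⪯?_ P i j | ≡.trans (≡.sym (entry≡ i j)) (Vec.[]=⇒lookup j∈)
  ... | yes p | _ = p
  ⇐ : ∀ i j → _⪯_ P i j → relation matrix i j
  ⇐ i j p = Vec.lookup⇒[]= j _ (≡.trans (entry≡ i j) (dec-true (_⪯?_ P i j) p))
  isPO : IsPartialOrderOn A (relation matrix)
  isPO = record
    { support = λ p → PO.support P (⇒ _ _ p)
    ; refl    = λ i∈ → ⇐ _ _ (PO.refl P i∈)
    ; antisym = λ p q → PO.antisym P (⇒ _ _ p) (⇒ _ _ q)
    ; trans   = λ p q → ⇐ _ _ (PO.trans P (⇒ _ _ p) (⇒ _ _ q))
    }
  found = select-complete (λ M → isPartialOrderOn? A (relation? M)) (vectors-complete subsets-complete matrix) isPO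
  ≗P : ∀ {R} → fromMatrix (proj₁ found) ≡ R → R ≗ P
  ≗P refl =
    (λ i j r → ⇒ i j (≡.subst (λ M → relation M i j) (≡.sym (proj₂ (proj₂ found))) r)) ,
    (λ i j p → ≡.subst (λ M → relation M i j) (proj₂ (proj₂ found)) (⇐ i j p))

-- Finite sums

module FiniteSum {k ℓ} (M : CommutativeMonoid k ℓ) where

  open CommutativeMonoid M renaming (Carrier to C; refl to ≈-refl; sym to ≈-sym; trans to ≈-trans)
  open SetoidReasoning setoid
  open CommutativeSemigroupProperties commutativeSemigroup using (interchange; x∙yz≈y∙xz)

  when : ∀ {x} {X : Set x} → Dec X → C → C
  when d a = if does d then a else ε

  when-cong : ∀ {x y} {X : Set x} {Y : Set y} (d : Dec X) (e : Dec Y) → (X → Y) → (Y → X) →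
              ∀ {a b} → a ≈ b → when d a ≈ when e b
  when-cong (yes _) (yes _) _ _ a≈b = a≈b
  when-cong (no _)  (no _)  _ _ _   = ≈-refl
  when-cong (yes x) (no ¬y) f _ _   = ⊥-elim (¬y (f x))
  when-cong (no ¬x) (yes y) _ f _   = ⊥-elim (¬x (f y))

  ∑ : ∀ {x} {X : Set x} → (X → C) → List X → C
  ∑ f = foldr (λ x s → f x ∙ s) ε

  module _ {x} {X : Set x} where

    ∑-cong : ∀ {f g : X → C} → (∀ x → f x ≈ g x) → ∀ xs → ∑ f xs ≈ ∑ g xs
    ∑-cong f≈g []       = ≈-refl
    ∑-cong f≈g (x ∷ xs) = ∙-cong (f≈g x) (∑-cong f≈g xs)

    ∑-map : ∀ {y} {Y : Set y} (f : X → C) (g : Y → X) ys → ∑ f (map g ys) ≡ ∑ (f ∘ g) ys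
    ∑-map f g ys = foldr-map (λ x s → f x ∙ s) g ε ys

    ∑-ε : (xs : List X) → ∑ (λ _ → ε) xs ≈ ε
    ∑-ε []       = ≈-refl
    ∑-ε (x ∷ xs) = ≈-trans (identityˡ _) (∑-ε xs)

    ∑-∙ : ∀ (f g : X → C) xs → ∑ (λ x → f x ∙ g x) xs ≈ ∑ f xs ∙ ∑ g xs
    ∑-∙ f g []       = ≈-sym (identityˡ ε)
    ∑-∙ f g (x ∷ xs) = ≈-trans (∙-congˡ (∑-∙ f g xs)) (interchange (f x) (g x) (∑ f xs) (∑ g xs))

    ∑-↭ : ∀ (f : X → C) {xs ys} → xs ↭ ys → ∑ f xs ≈ ∑ f ys
    ∑-↭ f ↭.refl          = ≈-refl
    ∑-↭ f (↭.prep x p)    = ∙-congˡ (∑-↭ f p)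
    ∑-↭ f (↭.swap x y p)  = ≈-trans (∙-congˡ (∙-congˡ (∑-↭ f p))) (x∙yz≈y∙xz (f x) (f y) _)
    ∑-↭ f (↭.trans p q)   = ≈-trans (∑-↭ f p) (∑-↭ f q)

    ∑-filter : ∀ {p} {P : X → Set p} (P? : ∀ x → Dec (P x)) (f : X → C) xs →
               ∑ f (filter P? xs) ≈ ∑ (λ x → when (P? x) (f x)) xs
    ∑-filter P? f []       = ≈-refl
    ∑-filter P? f (x ∷ xs) with does (P? x)
    ... | true  = ∙-congˡ (∑-filter P? f xs)
    ... | false = ≈-trans (∑-filter P? f xs) (≈-sym (identityˡ _))

    ∑-select : ∀ {p} {P : X → Set p} (P? : ∀ x → Dec (P x)) (f : X → C) xs →
               ∑ (f ∘ proj₁) (select P? xs) ≈ ∑ (λ x → when (P? x) (f x)) xs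
    ∑-select P? f xs = begin
      ∑ (f ∘ proj₁) (select P? xs)   ≡⟨ ∑-map f proj₁ (select P? xs) ⟨
      ∑ f (map proj₁ (select P? xs)) ≡⟨ ≡.cong (∑ f) (map-proj₁-select P? xs) ⟩
      ∑ f (filter P? xs)             ≈⟨ ∑-filter P? f xs ⟩
      ∑ (λ x → when (P? x) (f x)) xs ∎

    ∑-none : ∀ {p} {P : X → Set p} (P? : ∀ x → Dec (P x)) a {xs} → All (¬_ ∘ P) xs →
             ∑ (λ x → when (P? x) a) xs ≈ ε
    ∑-none P? a []         = ≈-refl
    ∑-none P? a {x ∷ _} (¬p ∷ ¬ps) rewrite dec-false (P? x) ¬p = ≈-trans (identityˡ _) (∑-none P? a ¬ps)

    -- Used to attribute the term of a composition to the one order that it factorizes.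
    ∑-one : ∀ {p} {P : X → Set p} (P? : ∀ x → Dec (P x)) a {xs} →
            AllPairs (λ x y → P x → ¬ P y) xs → Any P xs → ∑ (λ x → when (P? x) a) xs ≈ a
    ∑-one P? a {x ∷ _} (¬pp ∷ _) (here p) rewrite dec-true (P? x) p =
      ≈-trans (∙-congˡ (∑-none P? a (All.map (λ ¬p → ¬p p) ¬pp))) (identityʳ a)
    ∑-one P? a {x ∷ _} (¬pp ∷ ps) (there p)
      rewrite dec-false (P? x) (λ px → let ¬p , q = All.lookupAny ¬pp p in ¬p px q) =
      ≈-trans (identityˡ _) (∑-one P? a ps p)

    module _ {r p} {_~_ : Rel X r} {P : X → Set p}
      (~-sym : ∀ {x y} → x ~ y → y ~ x)
      (~-irrefl : ∀ {x} → P x → ¬ x ~ x)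
      (~-functional : ∀ {x y z} → P x → P y → P z → x ~ y → x ~ z → y ≡ z)
      (f : X → C) (cancel : ∀ {x y} → x ~ y → f x ∙ f y ≈ ε) where

      -- The mate of the head may stand anywhere in the tail, so a permutation brings it to the
      -- front, and the induction runs over a bound for the length.
      ∑-pairs : ∀ m {xs} → length xs ≤ m → Unique xs → All P xs →
                (∀ {x} → x ∈ₗ xs → ∃ λ y → y ∈ₗ xs × x ~ y) → ∑ f xs ≈ ε
      ∑-pairs m {[]} _ _ _ _ = ≈-refl
      ∑-pairs (suc m) {x ∷ xs} (s≤s l≤m) (x∉xs ∷ u) (px ∷ ps) mate with mate (here refl)
      ... | _ , here refl , x~x = ⊥-elim (~-irrefl px x~x)
      ... | y , there y∈xs , x~y with ys , zs , refl ← ∈-∃++ y∈xs = begin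
          f x ∙ ∑ f (ys ++ [ y ] ++ zs)  ≈⟨ ∙-congˡ (∑-↭ f σ) ⟩
          f x ∙ (f y ∙ ∑ f ws)           ≈⟨ assoc (f x) (f y) (∑ f ws) ⟨
          (f x ∙ f y) ∙ ∑ f ws           ≈⟨ ∙-cong (cancel x~y) rest ⟩
          ε ∙ ε                          ≈⟨ identityˡ ε ⟩
          ε                              ∎
        where
        ws = ys ++ zs
        σ : ys ++ [ y ] ++ zs ↭ y ∷ ws
        σ = shift y ys zs
        py = All.lookup ps y∈xs
        pws : All P (y ∷ ws)
        pws = All-resp-↭ σ ps
        uws : Unique (y ∷ ws)
        uws = Unique-resp-↭ (≡.setoid X) (↭.↭⇒↭ₛ σ) u

        -- Symmetry and functionality keep the mates of the remaining entries away from `x` and `y`,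
        -- so the shorter list is again perfectly matched.
        mate′ : ∀ {z} → z ∈ₗ ws → ∃ λ w → w ∈ₗ ws × z ~ w
        mate′ {z} z∈ws with mate (there (∈-resp-↭ (↭-sym σ) (there z∈ws)))
        ... | _ , here refl , z~x = ⊥-elim (All.lookup (AllPairs.head uws) z∈ws
                (~-functional px py (All.lookup pws (there z∈ws)) x~y (~-sym z~x)))
        ... | w , there w∈ , z~w with ∈-resp-↭ σ w∈
        ...   | there w∈ws = w , w∈ws , z~w
        ...   | here refl  = ⊥-elim (All.lookup x∉xs (∈-resp-↭ (↭-sym σ) (there z∈ws))
                  (~-functional py px (All.lookup pws (there z∈ws)) (~-sym x~y) (~-sym z~w)))

        rest : ∑ f ws ≈ ε
        rest = ∑-pairs m (ℕ.≤-trans (ℕ.≤-trans (ℕ.n≤1+n _) (ℕ.≤-reflexive (≡.sym (↭-length σ)))) l≤m)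
                 (AllPairs.tail uws) (All.tail pws) mate′

  ∑-swap : ∀ {x y} {X : Set x} {Y : Set y} (f : X → Y → C) xs ys →
           ∑ (λ x → ∑ (f x) ys) xs ≈ ∑ (λ y → ∑ (λ x → f x y) xs) ys
  ∑-swap f []       ys = ≈-sym (∑-ε ys)
  ∑-swap f (x ∷ xs) ys = ≈-trans (∙-congˡ (∑-swap f xs ys)) (≈-sym (∑-∙ (f x) _ ys))

-- Takeuchi's formula

factorization-splitting : {P Q : PO A} ((I , _) : Factorization Q P) → Splitting P Q (blocks I)
factorization-splitting {P = P} {Q} ((_ , c) , f) = factorization⇒splitting P Q c f

rearrange-≗ : {P Q R : PO A} → Q ⊑ R → ((I , _) (J , _) : Factorization Q P) → rearrange R I ≗ rearrange R J
rearrange-≗ {P = P} {Q} {R} Q⊑R fI@(I , _) fJ@(J , _) =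
  rearrange-⊑ P Q Q⊑R I J gI gJ , rearrange-⊑ P Q Q⊑R J I gJ gI
  where
  gI = factorization-splitting {P = P} {Q} fI
  gJ = factorization-splitting {P = P} {Q} fJ

-- Converse of `factorization-≗`; it ensures that no composition is lost when the terms are
-- collected by order.
≗-rearrange⇒factorization : {P Q : PO A} (I : SetComposition A) → P ≗ rearrange Q I → IsFactorization Q P (blocks I)
≗-rearrange⇒factorization {P = P} {Q} I@(_ , c) (P⊑ , ⊑P) = splitting⇒factorization P Q
  (arranged⇒splitting P Q (nonempty c) (disjoint c)
    (λ _ _ p → rearrange⇒Arranged Q I (P⊑ _ _ p)) (λ a → ⊑P _ _ (Arranged⇒rearrange Q I a)))
  (covers c)

-- Restriction to the diagonal blocks followed by inflation

Together : List (Subset n) → Rel (Fin n) 0ℓ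
Together Is i j = Any (λ I → i ∈ I × j ∈ I) Is

together? : (Is : List (Subset n)) → Decidable (Together Is)
together? Is i j = Any.any? (λ I → (i ∈? I) ×-dec (j ∈? I)) Is

together-⋃ : ∀ {i j} → Together Is i j → i ∈ ⋃ Is × j ∈ ⋃ Is
together-⋃ (here (i∈ , j∈)) = p⊆p∪q _ i∈ , p⊆p∪q _ j∈
together-⋃ {Is = I ∷ _} (there t) with i∈ , j∈ ← together-⋃ t = q⊆p∪q I _ i∈ , q⊆p∪q I _ j∈

module _ {ρ : Rel (Fin n) 0ℓ} where

  together⇒arranged : ∀ {i j} → Together Is i j → ρ i j → Arranged ρ Is i j
  together⇒arranged (here (i∈ , j∈)) r = within i∈ j∈ r
  together⇒arranged (there t)        r = later (together⇒arranged t r)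

  arranged-together : AllPairs Disjoint Is → ∀ {i j} → Together Is i j → Arranged ρ Is i j → ρ i j
  arranged-together (I# ∷ disj) (here _)  (within _ _ r) = r
  arranged-together (I# ∷ disj) (there _) (within _ _ r) = r
  arranged-together (I# ∷ disj) (here (_ , j∈)) (across _ j∈′) = ⊥-elim (clash (disjoint-⋃ I#) j∈ j∈′)
  arranged-together (I# ∷ disj) (there t) (across i∈ _) =
    ⊥-elim (clash (disjoint-⋃ I#) i∈ (proj₁ (together-⋃ t)))
  arranged-together (I# ∷ disj) (here (i∈ , _)) (later a) =
    ⊥-elim (clash (disjoint-⋃ I#) i∈ (proj₁ (Arranged-support a)))
  arranged-together (I# ∷ disj) (there t) (later a) = arranged-together disj t a

  arranged-apart : ∀ {σ : Rel (Fin n) 0ℓ} {i j} → ¬ Together Is i j → Arranged ρ Is i j → Arranged σ Is i j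
  arranged-apart ¬t (within i∈ j∈ _) = ⊥-elim (¬t (here (i∈ , j∈)))
  arranged-apart ¬t (across i∈ j∈)   = across i∈ j∈
  arranged-apart ¬t (later a)        = later (arranged-apart (¬t ∘ there) a)

module _ {c ℓ k ℓ′} (F : FiniteField c ℓ) (K : CommutativeRing k ℓ′) where

  open HopfMonoid F K
  open Func using (to)
  open UT using (entry)
  private
    module F = FiniteField F
    module K = CommutativeRing K
  open FiniteSum K.+-commutativeMonoid
  open RingProperties K.ring using (-1*x≈-x)

  -- The image of u under the block projections, included in UT_R again: the
  -- entries of u outside the diagonal blocks are set to 0.
  diagonalPart : ∀ {Is : List (Subset n)} (disj : AllPairs Disjoint Is) (R : PO (⋃ Is)) →
                 UT (dot* disj (restrict* Is R)) → UT R
  diagonalPart {Is = Is} disj R u = to (blockDiagonal* disj R) (to (split* disj (restrict* Is R)) u)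

  diagonalPart-apart : ∀ {Is : List (Subset n)} (disj : AllPairs Disjoint Is) (R : PO (⋃ Is)) u {i j} →
                       ¬ Together Is i j → entry (diagonalPart disj R u) i j F.≈ F.0#
  diagonalPart-apart [] R u {i} {j} ¬t = UT.support (ε {R = R}) {i} {j} λ r → ∉⊥ (proj₁ (PO.support R r))
  diagonalPart-apart {Is = I ∷ Is} (I# ∷ disj) R u {i} {j} ¬t = F.trans
    (F.+-cong (F.reflexive (if-false ((i ∈? I) ×-dec (j ∈? I)) (¬t ∘ here)))
      (diagonalPart-apart disj _ _ (¬t ∘ there)))
    (F.+-identityˡ F.0#)

  -- The block diagonal embedding adds the entries of its parts; by disjointness only the part of
  -- the block containing `i` and `j` contributes.
  diagonalPart-together : ∀ {Is : List (Subset n)} (disj : AllPairs Disjoint Is) (R : PO (⋃ Is)) u {i j} →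
                          Together Is i j → entry (diagonalPart disj R u) i j F.≈ entry u i j
  diagonalPart-together {Is = I ∷ Is} (I# ∷ disj) R u {i} {j} (here (i∈ , j∈)) = F.trans
    (F.+-cong (F.reflexive (if-true ((i ∈? I) ×-dec (j ∈? I)) (i∈ , j∈)))
      (diagonalPart-apart disj _ _ λ t → clash (disjoint-⋃ I#) i∈ (proj₁ (together-⋃ t))))
    (F.+-identityʳ (entry u i j))
  diagonalPart-together {Is = I ∷ Is} (I# ∷ disj) R u {i} {j} (there t) with i∈ , j∈ ← together-⋃ t = F.trans
    (F.+-cong (F.reflexive (if-false ((i ∈? I) ×-dec (j ∈? I)) λ (i∈I , _) → clash (disjoint-⋃ I#) i∈I i∈))
      (F.trans (diagonalPart-together disj _ _ t)
        (F.reflexive (if-true ((i ∈? ⋃ Is) ×-dec (j ∈? ⋃ Is)) (i∈ , j∈)))))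
    (F.+-identityˡ (entry u i j))


  module _ {Is : List (Subset n)} (disj : AllPairs Disjoint Is) (Q R : PO (⋃ Is))
           (u : UT (dot* disj (restrict* Is R))) where

    private
      QQ = dot* disj (restrict* Is Q)
      RR = dot* disj (restrict* Is R)

    diagonalPart-∈UT⁺ : u ∈UT QQ → diagonalPart disj R u ∈UT Q
    diagonalPart-∈UT⁺ u∈ i j i⋠j with together? Is i j
    ... | no ¬t = diagonalPart-apart disj R u ¬t
    ... | yes t = F.trans (diagonalPart-together disj R u t)
                    (u∈ i j λ r → i⋠j (arranged-together disj t (dot*⇒Arranged disj Q (λ q → q) r)))

    diagonalPart-∈UT⁻ : diagonalPart disj R u ∈UT Q → u ∈UT QQ
    diagonalPart-∈UT⁻ d∈ i j i⋠j with together? Is i j | _⪯?_ RR i j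
    ... | yes t | _      = F.trans (F.sym (diagonalPart-together disj R u t))
                             (d∈ i j λ q → i⋠j (Arranged⇒dot* disj Q (λ _ _ q → q) (together⇒arranged t q)))
    -- Off the diagonal blocks the two rearranged orders consist of the same pairs, so the support
    -- of `u` already gives the required zeros.
    ... | no _  | no ¬r  = UT.support u ¬r
    ... | no ¬t | yes r  = contradiction
      (Arranged⇒dot* disj Q (λ _ _ q → q) (arranged-apart ¬t (dot*⇒Arranged disj R (λ r → r) r))) i⋠j

  open SetoidReasoning K.setoid

  sign-suc : ∀ l → sign l K.+ sign (suc l) K.≈ K.0#
  sign-suc l = K.trans (K.+-congˡ (-1*x≈-x (sign l))) (K.-‿inverseʳ (sign l))

  -- Evaluation in the summand of S at one group element

  module _ {n} {A : Subset n} (S : PO A) (u : UT S) where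

    component-++ : ∀ x y → component (x ++ y) S u K.≈ component x S u K.+ component y S u
    component-++ []            y = K.sym (K.+-identityˡ _)
    component-++ ((P , φ) ∷ x) y = K.trans (K.+-congˡ (component-++ x y)) (K.sym (K.+-assoc _ _ _))

    component-concatMap : ∀ {x} {X : Set x} (g : X → ptt A) xs →
                          component (concatMap g xs) S u K.≈ ∑ (λ x → component (g x) S u) xs
    component-concatMap g []       = K.refl
    component-concatMap g (x ∷ xs) =
      K.trans (component-++ (g x) (concatMap g xs)) (K.+-congˡ (component-concatMap g xs))

    component-· : ∀ a x → component (a · x) S u K.≈ a K.* component x S u
    component-· a []            = K.sym (K.zeroʳ a)
    component-· a ((P , φ) ∷ x) = K.trans (K.+-cong (scaled (P ≗? S)) (component-· a x)) (K.sym (K.distribˡ a _ _))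
      where
      scaled : ∀ d → evaluate u (scale a φ) d K.≈ a K.* evaluate u φ d
      scaled (yes _) = K.refl
      scaled (no _)  = K.sym (K.zeroʳ a)

    -- The value at u of δ_{UT_P} in the summand of T.
    value : PO A → PO A → K.Carrier
    value P T = when (T ≗? S) [ u ∈UT? P ]?

    value-cong : ∀ {P P′ T T′} → P ≗ P′ → T ≗ T′ → value P T K.≈ value P′ T′
    value-cong {P} {P′} {T} {T′} (P⊑P′ , P′⊑P) T≗T′ = when-cong (T ≗? S) (T′ ≗? S)
      (≗-trans {P = T′} {T} {S} (≗-sym {P = T} {T′} T≗T′)) (≗-trans {P = T} {T′} {S} T≗T′)
      ([]?-cong (u ∈UT? P) (u ∈UT? P′)
        (λ u∈ i j i⋠j → u∈ i j (i⋠j ∘ P⊑P′ i j)) (λ u∈ i j i⋠j → u∈ i j (i⋠j ∘ P′⊑P i j)))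

    component-δ : ∀ P T (P◁T : P ◁ T) → component (δ P T P◁T) S u K.≈ value P T
    component-δ P T P◁T = K.trans (K.+-identityʳ _) (at (T ≗? S))
      where
      at : ∀ d → evaluate u (indicator P T P◁T) d K.≈ when d [ u ∈UT? P ]?
      at (yes _) = K.refl
      at (no _)  = K.refl

    -- Restriction followed by inflation pulls the indicator back along `diagonalPart`, and the
    -- diagonal part of an element lies in the group of `Q` exactly when the element lies in that of
    -- the rearranged `Q`.
    component-m∘Δ : ∀ Q R (Q◁R : Q ◁ R) I →
                    component (m∘Δ I (δ Q R Q◁R)) S u K.≈ value (rearrange Q I) (rearrange R I)
    component-m∘Δ Q R Q◁R (Is , record { covers = refl ; disjoint = disj }) =
      K.trans (K.+-identityʳ _) (at (RR ≗? S))
      where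
      QQ = dot* disj (restrict* Is Q)
      RR = dot* disj (restrict* Is R)
      at : ∀ d → evaluate u (Composition.function (split* disj (restrict* Is R))
                   (Composition.function (blockDiagonal* disj R) (indicator Q R Q◁R))) d K.≈ when d [ u ∈UT? QQ ]?
      at (no _)          = K.refl
      at (yes (_ , S⊑RR)) = []?-cong (diagonalPart disj R v ∈UT? Q) (u ∈UT? QQ)
        (diagonalPart-∈UT⁻ disj Q R v) (diagonalPart-∈UT⁺ disj Q R v)
        where v = extend S⊑RR u

    module _ (Q R : PO A) (Q◁R : Q ◁ R) where

      term : SetComposition A → K.Carrier
      term I = component (sign (length (blocks I)) · m∘Δ I (δ Q R Q◁R)) S u

      Q⊑R : Q ⊑ R
      Q⊑R = _◁_.subposet Q◁R

      -- With `T` free up to `≗`, one summand can serve all factorizations of `P`, and their terms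
      -- then differ only in sign.
      term-value : ∀ {P} ((I , _) : Factorization Q P) {T} → rearrange R I ≗ T →
                   term I K.≈ sign (length (blocks I)) K.* value P T
      term-value {P} fac@(I , _) {T} eq = K.trans (component-· (sign (length (blocks I))) (m∘Δ I (δ Q R Q◁R)))
        (K.*-congˡ (K.trans (component-m∘Δ Q R Q◁R I)
          (value-cong {rearrange Q I} {P} {rearrange R I} {T}
            (≗-sym {P = P} {rearrange Q I} (factorization-≗ {Q = Q} {P} fac)) eq)))

      module _ (P : PO A) where

        terms-cancel : (x y : Factorization Q P) (zs : List (Factorization Q P)) → let xs = x ∷ y ∷ zs in
          Unique (facBlocks xs) →
          (∀ {Is} → IsSetComposition A Is → IsFactorization Q P Is → Is ∈ₗ facBlocks xs) →
          ∑ (term ∘ proj₁) xs K.≈ K.0#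
        terms-cancel x y zs unique@((x≢y ∷ _) ∷ _) complete
          with equal-or-cut P Q (factorization-splitting {P = P} {Q} x) (factorization-splitting {P = P} {Q} y)
                 (≡.trans (covers (proj₂ (proj₁ x))) (≡.sym (covers (proj₂ (proj₁ y)))))
        ... | inj₁ x≡y = contradiction x≡y x≢y
        ... | inj₂ (D , cut) = begin
            ∑ (term ∘ proj₁) xs            ≈⟨ ∑-cong (λ fac → term-value {P} fac {rearrange R (proj₁ x)}
                                                (rearrange-≗ {P = P} {Q} {R} Q⊑R fac x)) xs ⟩
            ∑ (signed ∘ blocks ∘ proj₁) xs ≡⟨ ∑-map signed (blocks ∘ proj₁) xs ⟨
            ∑ signed (facBlocks xs)        ≈⟨ ∑-pairs (λ {Is} {Js} → partner-sym {Is = Is} {Js})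
                                                partner-irrefl partner-functional
                                                signed cancel _ ℕ.≤-refl unique
                                                (All.map⁺ (All.universal (λ (I , _) → nonempty (proj₂ I)) xs)) mate ⟩
            K.0#                           ∎
          where
          xs = x ∷ y ∷ zs

          -- All terms are moved to the summand belonging to `x`, so that each depends only on the
          -- length of its block list.
          signed : List (Subset n) → K.Carrier
          signed Is = sign (length Is) K.* value P (rearrange R (proj₁ x))

          cancel-merge : ∀ {Is Js} → Merge D Is Js → signed Js K.+ signed Is K.≈ K.0#
          cancel-merge {Is} {Js} m rewrite merge-length m = begin
            signed Js K.+ sign (suc (length Js)) K.* w              ≈⟨ K.distribʳ w (sign (length Js)) _ ⟨
            (sign (length Js) K.+ sign (suc (length Js))) K.* w     ≈⟨ K.*-congʳ (sign-suc (length Js)) ⟩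
            K.0# K.* w                                              ≈⟨ K.zeroˡ w ⟩
            K.0#                                                    ∎
            where w = value P (rearrange R (proj₁ x))

          cancel : ∀ {Is Js} → Partner {D = D} Is Js → signed Is K.+ signed Js K.≈ K.0#
          cancel (inj₁ m) = K.trans (K.+-comm _ _) (cancel-merge m)
          cancel (inj₂ m) = cancel-merge m

          mate : ∀ {Is} → Is ∈ₗ facBlocks xs → ∃ λ Js → Js ∈ₗ facBlocks xs × Partner {D = D} Is Js
          mate Is∈ with fac@((Is , c) , _) , _ , refl ← ∈-map⁻ (blocks ∘ proj₁) {xs = xs} Is∈
            with Js , Is~Js , g ← partner P Q (factorization-splitting {P = P} {Q} fac)
                   (≡.subst (λ C → Cut P Q C D)
                     (≡.trans (covers (proj₂ (proj₁ x))) (≡.sym (covers c))) cut)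
            = Js , complete (splitting⇒composition P Q g ⋃Js≡A) (splitting⇒factorization P Q g ⋃Js≡A) , Is~Js
            where
            ⋃Js≡A : ⋃ Js ≡ A
            ⋃Js≡A = ≡.trans (≡.sym (partner-⋃ Is~Js)) (covers c)

        component-signedδ : (xs : List (Factorization Q P)) → Unique (facBlocks xs) →
          (∀ {Is} → IsSetComposition A Is → IsFactorization Q P Is → Is ∈ₗ facBlocks xs) →
          component (signedδ Q R Q◁R P xs) S u K.≈ ∑ (term ∘ proj₁) xs
        component-signedδ [] _ _ = K.refl
        component-signedδ (fac@(I , _) ∷ []) _ _ = begin
          component (sign l · δ P T P◁T) S u    ≈⟨ component-· (sign l) (δ P T P◁T) ⟩
          sign l K.* component (δ P T P◁T) S u  ≈⟨ K.*-congˡ (component-δ P T P◁T) ⟩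
          sign l K.* value P T                  ≈⟨ term-value {P} fac {T} ((λ _ _ r → r) , λ _ _ r → r) ⟨
          term I                                ≈⟨ K.+-identityʳ (term I) ⟨
          term I K.+ K.0#                       ∎
          where
          l   = length (blocks I)
          T   = rearrange R I
          P◁T = rearrange-◁ {Q = Q} {P} {R} Q◁R fac
        -- With two or more factorizations `signedδ` is the empty formal sum, of value zero.
        component-signedδ (x ∷ y ∷ zs) unique complete = K.sym (terms-cancel x y zs unique complete)

      -- The orders factorized by `I` are those equivalent to `rearrange Q I`, and `posets` lists
      -- exactly one of these.
      ∑-factorized : ∀ I → ∑ (λ P → when (isFactorization? Q P (blocks I)) (term I)) (posets A) K.≈ term I
      ∑-factorized I = ∑-one (λ P → isFactorization? Q P (blocks I)) (term I)
        (AllPairs.map (λ {P} {P′} P≇P′ f f′ → P≇P′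
          (≗-trans {P = P} {rearrange Q I} {P′} (factorization-≗ {Q = Q} {P} (I , f))
            (≗-sym {P = P′} {rearrange Q I} (factorization-≗ {Q = Q} {P′} (I , f′))))) posets-distinct)
        (Any.map (λ {P} → ≗-rearrange⇒factorization {P = P} {Q} I) (posets-complete (rearrange Q I)))

      -- Double counting of pairs of an order and a composition factorizing it: by compositions the
      -- sum is Takeuchi's formula, by orders it runs over the lists `Fac Q P`.
      antipode-δ : component (antipode (δ Q R Q◁R)) S u K.≈
                   component (concatMap (λ P → signedδ Q R Q◁R P (Fac Q P)) (posets A)) S u
      antipode-δ = begin
        component (antipode (δ Q R Q◁R)) S u
          ≈⟨ component-concatMap _ (compositions A) ⟩
        ∑ term (compositions A)
          ≈⟨ ∑-cong ∑-factorized (compositions A) ⟨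
        ∑ (λ I → ∑ (λ P → factorized P I) (posets A)) (compositions A)
          ≈⟨ ∑-swap factorized (posets A) (compositions A) ⟨
        ∑ (λ P → ∑ (factorized P) (compositions A)) (posets A)
          ≈⟨ ∑-cong (λ P → ∑-select (λ I → isFactorization? Q P (blocks I)) term (compositions A)) (posets A) ⟨
        ∑ (λ P → ∑ (term ∘ proj₁) (Fac Q P)) (posets A)
          ≈⟨ ∑-cong (λ P → component-signedδ P (Fac Q P) (Fac-unique Q P) (Fac-complete Q P)) (posets A) ⟨
        ∑ (λ P → component (signedδ Q R Q◁R P (Fac Q P)) S u) (posets A)
          ≈⟨ component-concatMap _ (posets A) ⟨
        component (concatMap (λ P → signedδ Q R Q◁R P (Fac Q P)) (posets A)) S u ∎
        where
        factorized : PO A → SetComposition A → K.Carrier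
        factorized P I = when (isFactorization? Q P (blocks I)) (term I)

proposition4p8 : ∀ {c ℓ k ℓ′ : Level} (F : FiniteField c ℓ) (K : CommutativeRing k ℓ′) →
    let open HopfMonoid F K in
    ∀ {n} {A : Subset n} (Q R : PO A) (Q◁R : Q ◁ R) →
    antipode (δ Q R Q◁R) ≃ concatMap (λ P → signedδ Q R Q◁R P (Fac Q P)) (posets A)
proposition4p8 F K Q R Q◁R S u = antipode-δ F K S u Q R Q◁R
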